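{- Let $G^\sigma$ be an oriented graph whose underlying graph $G$ is a simple connected graph with $n$ vertices and $m$ edges. Then $$sr(G^\sigma)-\alpha(G)\geqslant 4n-2m-3\sqrt{n(n-1)-2m+\tfrac{1}{4}}-\tfrac{7}{2},$$ with equality if and only if $G\cong S_n$ or $G\cong C_3$.
   Context: An oriented graph $G^\sigma$ is obtained from a simple graph $G$ by assigning a direction to each edge. Its skew-adjacency matrix $S(G^\sigma)=[s_{x,y}]$ has $s_{x,y}=1$ if there is an arc from $x$ to $y$, $s_{x,y}=-1$ if there is an arc from $y$ to $x$, and $0$ otherwise; the skew-rank $sr(G^\sigma)$ is the rank of $S(G^\sigma)$. $\alpha(G)$ is the independence number of $G$. $S_n$ denotes the star on $n$ vertices (the single vertex when $n=1$) and $C_3$ the triangle. -}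

module Defs where

open import Algebra.Bundles using (CommutativeRing)
import Algebra.Properties.Semiring.Sum as SemiringSum
open import Data.Bool using (Bool; true; false; not; _∧_; if_then_else_; T)
import Data.Bool.Properties as Bool
open import Data.Empty using (⊥-elim)
open import Data.Fin using (Fin; zero; suc; toℕ; punchIn)
import Data.Fin.Properties as Fin
open import Data.Fin.Subset using (Subset; _∈_; ∣_∣) renaming (⊥ to ∅)
import Data.Fin.Subset.Properties as Subset
import Data.Integer as ℤ
import Data.Integer.Properties as ℤ
open import Data.List using (length; filterᵇ; cartesianProduct; allFin)
open import Data.Nat as ℕ using (ℕ; zero; suc)
import Data.Nat.Coprimality as Coprime
import Data.Nat.Properties as ℕ
open import Data.Product using (Σ; ∃; ∃₂; _×_; _,_; proj₁; uncurry)
open import Data.Rational using (ℚ; mkℚ; 0ℚ; 1ℚ; ½; _+_; _-_; _*_; -_; 1/_; _/_; _<_; _≤_; *≤*; NonZero; NonNegative; Positive; ≢-nonZero; positive; nonNegative)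
import Data.Rational.Properties as ℚ
open import Data.Rational.Solver using (module +-*-Solver)
open import Data.Sum using (_⊎_; inj₁; inj₂)
open import Data.Vec as Vec using (Vec; []; _∷_)
open import Data.Vec.Functional as Vector using (Vector; insertAt)
import Data.Vec.Functional.Properties as Vector
open import Function using (_∘_; _↔_; Inverse)
open import Relation.Binary.Construct.Closure.ReflexiveTransitive using (Star)
open import Relation.Binary.Definitions using (tri<; tri≈; tri>)
open import Relation.Binary.PropositionalEquality using (_≡_; _≢_; refl; sym; trans; cong; cong₂; subst; subst₂; module ≡-Reasoning)
open import Relation.Nullary using (¬_; Dec; yes; no; does; contradiction; ¬?)
open import Relation.Nullary.Decidable using (map′; _→-dec_; _×-dec_; decidable-stable)
open import Relation.Unary using (Pred; Decidable)
open import Level using (0ℓ)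

open SemiringSum (CommutativeRing.semiring ℚ.+-*-commutativeRing) using (sum; sum-remove; sum-cong-≗; sum-replicate-zero)

fromℕ : ℕ → ℚ
fromℕ n = ℤ.+ n / 1

IsMaximum : Pred ℕ 0ℓ → Pred ℕ 0ℓ
IsMaximum P r = P r × (∀ k → P k → k ℕ.≤ r)

maximum : {P : Pred ℕ 0ℓ} → Decidable P → P 0 →
          (b : ℕ) → (∀ k → P k → k ℕ.≤ b) → ∃ (IsMaximum P)
maximum P? P0 zero    bound = 0 , P0 , bound
maximum P? P0 (suc b) bound with P? (suc b)
... | yes Pb = suc b , Pb , bound
... | no ¬Pb = maximum P? P0 b λ k Pk →
  ℕ.≤-pred (ℕ.≤∧≢⇒< (bound k Pk) λ { refl → ¬Pb Pk })

record Graph (n : ℕ) : Set where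
  field
    adj     : Fin n → Fin n → Bool
    adj-sym : ∀ x y → adj x y ≡ adj y x
    no-loop : ∀ x → adj x x ≡ false

  Adjacent : Fin n → Fin n → Set
  Adjacent x y = T (adj x y)

open Graph public

record Orientation {n : ℕ} (G : Graph n) : Set where
  field
    arc          : Fin n → Fin n → Bool
    arc-adjacent : ∀ x y → T (arc x y) → Adjacent G x y
    arc-total    : ∀ x y → Adjacent G x y → T (arc x y) ⊎ T (arc y x)
    arc-asym     : ∀ x y → T (arc x y) → ¬ T (arc y x)

open Orientation public

-- Number of edges: each is counted once, as the pair (x , y) with x < y.
size : ∀ {n} → Graph n → ℕ
size {n} G = length (filterᵇ (uncurry λ x y → (toℕ x ℕ.<ᵇ toℕ y) ∧ adj G x y)
                             (cartesianProduct (allFin n) (allFin n)))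

-- The graph without vertices does not count as connected.
Connected : ∀ {n} → Graph n → Set
Connected {n} G = 0 ℕ.< n × (∀ x y → Star (Adjacent G) x y)

infix 4 _≅_

_≅_ : ∀ {m n} → Graph m → Graph n → Set
_≅_ {m} {n} G H = Σ (Fin m ↔ Fin n) λ f →
  ∀ x y → adj G x y ≡ adj H (Inverse.to f x) (Inverse.to f y)

star : (n : ℕ) → Graph n
star n = record { adj = a ; adj-sym = a-sym ; no-loop = a-irr }
  where
  a : ∀ {n} → Fin n → Fin n → Bool
  a zero    zero    = false
  a zero    (suc _) = true
  a (suc _) zero    = true
  a (suc _) (suc _) = false
  a-sym : ∀ {n} (x y : Fin n) → a x y ≡ a y x
  a-sym zero    zero    = refl
  a-sym zero    (suc _) = refl
  a-sym (suc _) zero    = refl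
  a-sym (suc _) (suc _) = refl
  a-irr : ∀ {n} (x : Fin n) → a x x ≡ false
  a-irr zero    = refl
  a-irr (suc _) = refl

triangle : Graph 3
triangle = record
  { adj     = λ x y → not (does (x Fin.≟ y))
  ; adj-sym = a-sym
  ; no-loop = a-irr
  }
  where
  a-sym : ∀ (x y : Fin 3) → not (does (x Fin.≟ y)) ≡ not (does (y Fin.≟ x))
  a-sym x y with x Fin.≟ y | y Fin.≟ x
  ... | yes _  | yes _  = refl
  ... | no  _  | no  _  = refl
  ... | yes eq | no  ne = contradiction (sym eq) ne
  ... | no  ne | yes eq = contradiction (sym eq) ne
  a-irr : ∀ (x : Fin 3) → not (does (x Fin.≟ x)) ≡ false
  a-irr x with x Fin.≟ x
  ... | yes _  = refl
  ... | no  ne = contradiction refl ne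

Independent : ∀ {n} → Graph n → Subset n → Set
Independent G p = ∀ x y → x ∈ p → y ∈ p → ¬ Adjacent G x y

IndependentSetOfSize : ∀ {n} → Graph n → ℕ → Set
IndependentSetOfSize G k = ∃ λ p → Independent G p × ∣ p ∣ ≡ k

independence-number-exists : ∀ {n} (G : Graph n) → ∃ (IsMaximum (IndependentSetOfSize G))
independence-number-exists {n} G = maximum
  (λ k → Subset.anySubset? λ p → independent? p ×-dec (∣ p ∣ ℕ.≟ k))
  (∅ , (λ x _ x∈∅ → contradiction x∈∅ Subset.∉⊥) , Subset.∣⊥∣≡0 n)
  n
  (λ { _ (p , _ , refl) → Subset.∣p∣≤n p })
  where
  independent? : Decidable (Independent G)
  independent? p = Fin.all? λ x → Fin.all? λ y →
    (x Subset.∈? p) →-dec ((y Subset.∈? p) →-dec ¬? (Bool.T? (adj G x y)))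

α : ∀ {n} → Graph n → ℕ
α G = proj₁ (independence-number-exists G)

Matrix : ℕ → ℕ → Set
Matrix m n = Fin m → Fin n → ℚ

LinearlyIndependent : ∀ {k m} → (Fin k → Vector ℚ m) → Set
LinearlyIndependent {k} {m} v = (c : Vector ℚ k) →
  (∀ i → sum (λ j → c j * v j i) ≡ 0ℚ) → ∀ j → c j ≡ 0ℚ

IndependentColumns : ∀ {m n} → Matrix m n → ℕ → Set
IndependentColumns {n = n} A k = ∃ λ (cols : Vec (Fin n) k) →
  LinearlyIndependent λ j i → A i (Vec.lookup cols j)

module Elimination where
  open ≡-Reasoning

  sum-eliminate : ∀ {k} (c V a : Vector ℚ k) (P : ℚ) →
    sum (λ i → c i * (V i - a i * P)) ≡ (- sum (λ i → c i * a i)) * P + sum (λ i → c i * V i)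
  sum-eliminate {zero}  c V a P = solve 1 (λ P → con 0ℚ := (:- con 0ℚ) :* P :+ con 0ℚ) refl P
    where open +-*-Solver
  sum-eliminate {suc k} c V a P = trans
    (cong (λ z → c zero * (V zero - a zero * P) + z) (sum-eliminate (c ∘ suc) (V ∘ suc) (a ∘ suc) P))
    (solve 6 (λ c V a P s t →
       c :* (V :- a :* P) :+ ((:- s) :* P :+ t) := (:- (c :* a :+ s)) :* P :+ (c :* V :+ t))
       refl (c zero) (V zero) (a zero) P (sum λ i → c (suc i) * a (suc i)) (sum λ i → c (suc i) * V (suc i)))
    where open +-*-Solver

  sum-zero : ∀ {k} {f : Vector ℚ k} → (∀ i → f i ≡ 0ℚ) → sum f ≡ 0ℚ
  sum-zero {k} f≡0 = trans (sum-cong-≗ f≡0) (sum-replicate-zero k)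

  *-cancel-zero : ∀ c d → d ≢ 0ℚ → c * d ≡ 0ℚ → c ≡ 0ℚ
  *-cancel-zero c d d≢0 eq = begin
    c                ≡⟨ ℚ.*-identityʳ c ⟨
    c * 1ℚ           ≡⟨ cong (c *_) (ℚ.*-inverseʳ d) ⟨
    c * (d * 1/ d)   ≡⟨ ℚ.*-assoc c d (1/ d) ⟨
    (c * d) * 1/ d   ≡⟨ cong (_* 1/ d) eq ⟩
    0ℚ * 1/ d        ≡⟨ ℚ.*-zeroˡ (1/ d) ⟩
    0ℚ               ∎
    where instance _ = ≢-nonZero d≢0

  module Pivot {k m} (v : Fin (suc k) → Vector ℚ (suc m)) (p : Fin (suc k)) (vp≢0 : v p zero ≢ 0ℚ) where
    instance
      pivot-nonZero : NonZero (v p zero)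
      pivot-nonZero = ≢-nonZero vp≢0

    a : Vector ℚ k
    a i = v (punchIn p i) zero * 1/ (v p zero)

    w : Fin k → Vector ℚ m
    w i x = v (punchIn p i) (suc x) - a i * v p (suc x)

    cancels : ∀ i → v (punchIn p i) zero - a i * v p zero ≡ 0ℚ
    cancels i = begin
      u - (u * 1/ d) * d   ≡⟨ cong (λ z → u - z) (ℚ.*-assoc u (1/ d) d) ⟩
      u - u * (1/ d * d)   ≡⟨ cong (λ z → u - u * z) (ℚ.*-inverseˡ d) ⟩
      u - u * 1ℚ           ≡⟨ cong (λ z → u - z) (ℚ.*-identityʳ u) ⟩
      u - u                ≡⟨ ℚ.+-inverseʳ u ⟩
      0ℚ                   ∎
      where
      u = v (punchIn p i) zero
      d = v p zero

    split : ∀ (c : Vector ℚ (suc k)) x →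
      sum (λ j → c j * v j x) ≡ c p * v p x + sum (λ i → c (punchIn p i) * v (punchIn p i) x)
    split c x = sum-remove {i = p} (λ j → c j * v j x)

    shrink : LinearlyIndependent v → LinearlyIndependent w
    shrink indep c cw≡0 i = trans (sym (Vector.insertAt-punchIn c p cp i)) (indep c′ c′v≡0 (punchIn p i))
      where
      cp = - sum (λ i → c i * a i)
      c′ = insertAt c p cp
      rewritten : ∀ x → sum (λ j → c′ j * v j x) ≡
                        sum (λ i → c i * (v (punchIn p i) x - a i * v p x))
      rewritten x = begin
        sum (λ j → c′ j * v j x)
          ≡⟨ split c′ x ⟩
        c′ p * v p x + sum (λ i → c′ (punchIn p i) * v (punchIn p i) x)
          ≡⟨ cong₂ _+_ (cong (_* v p x) (Vector.insertAt-lookup c p cp))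
                       (sum-cong-≗ λ i → cong (_* v (punchIn p i) x) (Vector.insertAt-punchIn c p cp i)) ⟩
        cp * v p x + sum (λ i → c i * v (punchIn p i) x)
          ≡⟨ sum-eliminate c (λ i → v (punchIn p i) x) a (v p x) ⟨
        sum (λ i → c i * (v (punchIn p i) x - a i * v p x)) ∎
      c′v≡0 : ∀ x → sum (λ j → c′ j * v j x) ≡ 0ℚ
      c′v≡0 zero    = trans (rewritten zero)
        (sum-zero λ i → trans (cong (c i *_) (cancels i)) (ℚ.*-zeroʳ (c i)))
      c′v≡0 (suc x) = trans (rewritten (suc x)) (cw≡0 x)

    grow : LinearlyIndependent w → LinearlyIndependent v
    grow indep c cv≡0 = λ j → helper j (p Fin.≟ j)
      where
      c′ : Vector ℚ k
      c′ i = c (punchIn p i)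
      s = sum (λ i → c′ i * a i)

      cp≡-s : c p + s ≡ 0ℚ
      cp≡-s = *-cancel-zero (c p + s) (v p zero) vp≢0 (begin
        (c p + s) * d
          ≡⟨ solve 3 (λ c s d → (c :+ s) :* d := c :* d :+ (con 0ℚ :- (:- s) :* d)) refl (c p) s d ⟩
        c p * d + (0ℚ - (- s) * d)
          ≡⟨ cong (λ z → c p * d + (z - (- s) * d)) zero-sum ⟨
        c p * d + (((- s) * d + t) - (- s) * d)
          ≡⟨ solve 3 (λ x y t → x :+ ((y :+ t) :- y) := x :+ t) refl (c p * d) ((- s) * d) t ⟩
        c p * d + t
          ≡⟨ split c zero ⟨
        sum (λ j → c j * v j zero)
          ≡⟨ cv≡0 zero ⟩
        0ℚ ∎)
        where
        open +-*-Solver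
        d = v p zero
        t = sum (λ i → c′ i * v (punchIn p i) zero)
        zero-sum : (- s) * d + t ≡ 0ℚ
        zero-sum = trans (sym (sum-eliminate c′ (λ i → v (punchIn p i) zero) a d))
          (sum-zero λ i → trans (cong (c′ i *_) (cancels i)) (ℚ.*-zeroʳ (c′ i)))

      c′w≡0 : ∀ x → sum (λ i → c′ i * w i x) ≡ 0ℚ
      c′w≡0 x = begin
        sum (λ i → c′ i * w i x)
          ≡⟨ sum-eliminate c′ (λ i → v (punchIn p i) (suc x)) a P ⟩
        (- s) * P + t
          ≡⟨ solve 4 (λ c s P t → (:- s) :* P :+ t := (c :* P :+ t) :- (c :+ s) :* P) refl (c p) s P t ⟩
        (c p * P + t) - (c p + s) * P
          ≡⟨ cong₂ (λ y z → y - z * P) (trans (sym (split c (suc x))) (cv≡0 (suc x))) cp≡-s ⟩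
        0ℚ - 0ℚ * P
          ≡⟨ solve 1 (λ P → con 0ℚ :- con 0ℚ :* P := con 0ℚ) refl P ⟩
        0ℚ ∎
        where
        open +-*-Solver
        P = v p (suc x)
        t = sum (λ i → c′ i * v (punchIn p i) (suc x))

      c′≡0 : ∀ i → c′ i ≡ 0ℚ
      c′≡0 = indep c′ c′w≡0

      helper : ∀ j → Dec (p ≡ j) → c j ≡ 0ℚ
      helper j (no p≢j)   = subst (λ z → c z ≡ 0ℚ) (Fin.punchIn-punchOut p≢j) (c′≡0 _)
      helper j (yes refl) = begin
        c p       ≡⟨ ℚ.+-identityʳ (c p) ⟨
        c p + 0ℚ  ≡⟨ cong (λ z → c p + z) (sum-zero λ i → trans (cong (_* a i) (c′≡0 i)) (ℚ.*-zeroˡ (a i))) ⟨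
        c p + s   ≡⟨ cp≡-s ⟩
        0ℚ        ∎

  linearlyIndependent? : ∀ {k m} (v : Fin k → Vector ℚ m) → Dec (LinearlyIndependent v)
  linearlyIndependent? {zero}          v = yes λ _ _ ()
  linearlyIndependent? {suc k} {zero}  v = no λ indep →
    contradiction (indep (λ _ → 1ℚ) (λ ()) zero) λ ()
  linearlyIndependent? {suc k} {suc m} v with Fin.any? (λ j → ¬? (v j zero ℚ.≟ 0ℚ))
  ... | yes (p , vp≢0) = map′ grow shrink (linearlyIndependent? w)
    where open Pivot v p vp≢0
  ... | no all-zero = map′
    (λ indep c cv≡0 → indep c (cv≡0 ∘ suc))
    (λ indep c cv≡0 → indep c λ where
      zero    → sum-zero λ j → trans (cong (c j *_) (v≡0 j)) (ℚ.*-zeroʳ (c j))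
      (suc x) → cv≡0 x)
    (linearlyIndependent? (λ j x → v j (suc x)))
    where
    v≡0 : ∀ j → v j zero ≡ 0ℚ
    v≡0 j = decidable-stable (v j zero ℚ.≟ 0ℚ) λ ne → all-zero (j , ne)

  anyVec? : ∀ {n} k {P : Vec (Fin n) k → Set} → Decidable P → Dec (∃ P)
  anyVec? zero    P? = map′ ([] ,_) (λ { ([] , p) → p }) (P? [])
  anyVec? (suc k) P? = map′
    (λ { (x , xs , p) → x ∷ xs , p })
    (λ { (x ∷ xs , p) → x , xs , p })
    (Fin.any? λ x → anyVec? k λ xs → P? (x ∷ xs))

  indicator : ∀ {k} → Fin k → Vector ℚ k
  indicator i j = if does (i Fin.≟ j) then 1ℚ else 0ℚ

  indicator-same : ∀ {k} (i : Fin k) → indicator i i ≡ 1ℚ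
  indicator-same i with i Fin.≟ i
  ... | yes _  = refl
  ... | no  ne = contradiction refl ne

  indicator-different : ∀ {k} {i j : Fin k} → i ≢ j → indicator i j ≡ 0ℚ
  indicator-different {i = i} {j} i≢j with i Fin.≟ j
  ... | yes eq = contradiction eq i≢j
  ... | no  _  = refl

  sum-indicator : ∀ {k} (i : Fin k) (f : Vector ℚ k) → sum (λ j → indicator i j * f j) ≡ f i
  sum-indicator {suc k} i f = begin
    sum (λ j → indicator i j * f j)
      ≡⟨ sum-remove {i = i} (λ j → indicator i j * f j) ⟩
    indicator i i * f i + sum (λ j → indicator i (punchIn i j) * f (punchIn i j))
      ≡⟨ cong₂ _+_
           (trans (cong (_* f i) (indicator-same i)) (ℚ.*-identityˡ (f i)))
           (sum-zero λ j → trans (cong (_* f (punchIn i j)) (indicator-different (Fin.punchInᵢ≢i i j ∘ sym)))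
                                 (ℚ.*-zeroˡ (f (punchIn i j)))) ⟩
    f i + 0ℚ
      ≡⟨ ℚ.+-identityʳ (f i) ⟩
    f i ∎

  independent-injective : ∀ {m n k} (A : Matrix m n) (cols : Fin k → Fin n) →
    LinearlyIndependent (λ j i → A i (cols j)) → ∀ {x y} → cols x ≡ cols y → x ≡ y
  independent-injective A cols indep {x} {y} same = decidable-stable (x Fin.≟ y) λ x≢y →
    contradiction
      (trans (sym (trans (cong₂ _-_ (indicator-same x) (indicator-different (x≢y ∘ sym))) refl))
             (indep (λ j → indicator x j - indicator y j) vanishes x))
      λ ()
    where
    sum-difference : ∀ {k} (c d f : Vector ℚ k) →
      sum (λ j → (c j - d j) * f j) ≡ sum (λ j → c j * f j) - sum (λ j → d j * f j)
    sum-difference {zero}  c d f = refl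
    sum-difference {suc k} c d f = trans
      (cong (λ z → (c zero - d zero) * f zero + z) (sum-difference (c ∘ suc) (d ∘ suc) (f ∘ suc)))
      (solve 5 (λ c d f s t → (c :- d) :* f :+ (s :- t) := (c :* f :+ s) :- (d :* f :+ t))
         refl (c zero) (d zero) (f zero)
         (sum λ j → c (suc j) * f (suc j)) (sum λ j → d (suc j) * f (suc j)))
      where open +-*-Solver
    vanishes : ∀ i → sum (λ j → (indicator x j - indicator y j) * A i (cols j)) ≡ 0ℚ
    vanishes i = begin
      sum (λ j → (indicator x j - indicator y j) * f j)
        ≡⟨ sum-difference (indicator x) (indicator y) f ⟩
      sum (λ j → indicator x j * f j) - sum (λ j → indicator y j * f j)
        ≡⟨ cong₂ _-_ (sum-indicator x f) (trans (sum-indicator y f) (cong (A i) (sym same))) ⟩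
      f x - f x
        ≡⟨ ℚ.+-inverseʳ (f x) ⟩
      0ℚ ∎
      where
      f : Vector ℚ _
      f j = A i (cols j)

rank-exists : ∀ {m n} (A : Matrix m n) → ∃ (IsMaximum (IndependentColumns A))
rank-exists {n = n} A = maximum
  (λ k → anyVec? k λ cols → linearlyIndependent? (λ j i → A i (Vec.lookup cols j)))
  ([] , λ _ _ ())
  n
  (λ { k (cols , indep) → Fin.injective⇒≤ (independent-injective A (Vec.lookup cols) indep) })
  where open Elimination

-- For a matrix with rational entries, rank over ℚ and rank over ℝ agree.
rank : ∀ {m n} → Matrix m n → ℕ
rank A = proj₁ (rank-exists A)

skewAdjacency : ∀ {n} {G : Graph n} → Orientation G → Matrix n n
skewAdjacency σ x y =
  if arc σ x y then 1ℚ else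
  if arc σ y x then - 1ℚ else
  0ℚ

sr : ∀ {n} {G : Graph n} → Orientation G → ℕ
sr σ = rank (skewAdjacency σ)

-- Two-sided Dedekind cuts

record ℝ : Set₁ where
  field
    Lower Upper     : ℚ → Set
    lower-inhabited : ∃ Lower
    upper-inhabited : ∃ Upper
    lower-closed    : ∀ {p q} → p < q → Lower q → Lower p
    upper-closed    : ∀ {p q} → p < q → Upper p → Upper q
    lower-open      : ∀ {p} → Lower p → ∃ λ q → p < q × Lower q
    upper-open      : ∀ {q} → Upper q → ∃ λ p → p < q × Upper p
    disjoint        : ∀ {q} → Lower q → ¬ Upper q
    located         : ∀ {p q} → p < q → Lower p ⊎ Upper q

  lower<upper : ∀ {p q} → Lower p → Upper q → p < q
  lower<upper {p} {q} Lp Uq with ℚ.<-cmp p q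
  ... | tri< p<q _ _  = p<q
  ... | tri≈ _ refl _ = ⊥-elim (disjoint Lp Uq)
  ... | tri> _ _ q<p  = ⊥-elim (disjoint (lower-closed q<p Lp) Uq)

open ℝ public using (Lower; Upper)

infix 4 _≤ᴿ_ _≥ᴿ_ _≈ᴿ_

_≤ᴿ_ _≥ᴿ_ _≈ᴿ_ : ℝ → ℝ → Set
x ≤ᴿ y = ∀ q → Lower x q → Lower y q
x ≥ᴿ y = y ≤ᴿ x
x ≈ᴿ y = x ≤ᴿ y × y ≤ᴿ x

private
  p<p+1 : ∀ p → p < p + 1ℚ
  p<p+1 p = subst (_< p + 1ℚ) (ℚ.+-identityʳ p) (ℚ.+-monoʳ-< p (ℚ.positive⁻¹ 1ℚ))

  p-1<p : ∀ p → p - 1ℚ < p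
  p-1<p p = subst (p - 1ℚ <_) (ℚ.+-identityʳ p) (ℚ.+-monoʳ-< p (ℚ.negative⁻¹ (- 1ℚ)))

  neg-involutive : ∀ p → - (- p) ≡ p
  neg-involutive = solve 1 (λ p → :- (:- p) := p) refl
    where open +-*-Solver

fromℚ : ℚ → ℝ
fromℚ r = record
  { Lower           = _< r
  ; Upper           = r <_
  ; lower-inhabited = r - 1ℚ , p-1<p r
  ; upper-inhabited = r + 1ℚ , p<p+1 r
  ; lower-closed    = ℚ.<-trans
  ; upper-closed    = λ p<q r<p → ℚ.<-trans r<p p<q
  ; lower-open      = λ p<r → let q , p<q , q<r = ℚ.<-dense p<r in q , p<q , q<r
  ; upper-open      = λ r<q → let p , r<p , p<q = ℚ.<-dense r<q in p , p<q , r<p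
  ; disjoint        = ℚ.<-asym
  ; located         = loc
  }
  where
  loc : ∀ {p q} → p < q → p < r ⊎ r < q
  loc {p} {q} p<q with p ℚ.<? r
  ... | yes p<r = inj₁ p<r
  ... | no  p≮r = inj₂ (ℚ.≤-<-trans (ℚ.≮⇒≥ p≮r) p<q)

-- √ d is the supremum of 0 and all r with r * r ≤ d; thus √ d = 0 when d < 0.
√ : ℚ → ℝ
√ d = record
  { Lower           = λ q → ∃ λ r → q < r × (r ≤ 0ℚ ⊎ r * r ≤ d)
  ; Upper           = λ q → ∃ λ r → r < q × 0ℚ ≤ r × d ≤ r * r
  ; lower-inhabited = - 1ℚ , 0ℚ , ℚ.negative⁻¹ (- 1ℚ) , inj₁ ℚ.≤-refl
  ; upper-inhabited = upper
  ; lower-closed    = λ { p<q (r , q<r , Pr) → r , ℚ.<-trans p<q q<r , Pr }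
  ; upper-closed    = λ { p<q (r , r<p , Pr) → r , ℚ.<-trans r<p p<q , Pr }
  ; lower-open      = λ { (r , p<r , Pr) → let q , p<q , q<r = ℚ.<-dense p<r in q , p<q , r , q<r , Pr }
  ; upper-open      = λ { (r , r<q , Pr) → let p , r<p , p<q = ℚ.<-dense r<q in p , p<q , r , r<p , Pr }
  ; disjoint        = disj
  ; located         = loc
  }
  where
  upper : ∃₂ λ q r → r < q × 0ℚ ≤ r × d ≤ r * r
  upper with ℚ.≤-total d 1ℚ
  ... | inj₁ d≤1 = 1ℚ + 1ℚ , 1ℚ , p<p+1 1ℚ , ℚ.nonNegative⁻¹ 1ℚ , d≤1
  ... | inj₂ 1≤d = d + 1ℚ , d , p<p+1 d , 0≤d ,
        subst (_≤ d * d) (ℚ.*-identityˡ d) (ℚ.*-monoʳ-≤-nonNeg d {{nonNegative 0≤d}} 1≤d)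
    where
    0≤d : 0ℚ ≤ d
    0≤d = ℚ.≤-trans (ℚ.nonNegative⁻¹ 1ℚ) 1≤d

  square-mono : ∀ {r s} → 0ℚ ≤ r → r < s → r * r < s * s
  square-mono {r} {s} 0≤r r<s = ℚ.≤-<-trans
    (ℚ.*-monoˡ-≤-nonNeg r {{nonNegative 0≤r}} (ℚ.<⇒≤ r<s))
    (ℚ.*-monoˡ-<-pos s {{positive (ℚ.≤-<-trans 0≤r r<s)}} r<s)

  disj : ∀ {q} → (∃ λ r → q < r × (r ≤ 0ℚ ⊎ r * r ≤ d)) → ¬ (∃ λ r → r < q × 0ℚ ≤ r × d ≤ r * r)
  disj (r , q<r , inj₁ r≤0) (s , s<q , 0≤s , _) =
    ℚ.<-irrefl refl (ℚ.<-≤-trans (ℚ.≤-<-trans 0≤s (ℚ.<-trans s<q q<r)) r≤0)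
  disj (r , q<r , inj₂ rr≤d) (s , s<q , 0≤s , d≤ss) =
    ℚ.<-irrefl refl (ℚ.<-≤-trans (square-mono 0≤s (ℚ.<-trans s<q q<r)) (ℚ.≤-trans rr≤d d≤ss))

  loc : ∀ {p q} → p < q → (∃ λ r → p < r × (r ≤ 0ℚ ⊎ r * r ≤ d)) ⊎ (∃ λ r → r < q × 0ℚ ≤ r × d ≤ r * r)
  loc p<q with ℚ.<-dense p<q
  ... | s , p<s , s<q with ℚ.≤-total s 0ℚ | ℚ.≤-total (s * s) d
  ...   | inj₁ s≤0 | _         = inj₁ (s , p<s , inj₁ s≤0)
  ...   | inj₂ _   | inj₁ ss≤d = inj₁ (s , p<s , inj₂ ss≤d)
  ...   | inj₂ 0≤s | inj₂ d≤ss = inj₂ (s , s<q , 0≤s , d≤ss)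

infix  8 -ᴿ_
infixl 7 _·ᴿ_
infixl 6 _+ᴿ_ _-ᴿ_

-ᴿ_ : ℝ → ℝ
-ᴿ x = record
  { Lower           = λ q → Upper x (- q)
  ; Upper           = λ q → Lower x (- q)
  ; lower-inhabited = let q , Uq = upper-inhabited in - q , subst (Upper x) (sym (neg-involutive q)) Uq
  ; upper-inhabited = let q , Lq = lower-inhabited in - q , subst (Lower x) (sym (neg-involutive q)) Lq
  ; lower-closed    = λ p<q → upper-closed (ℚ.neg-antimono-< p<q)
  ; upper-closed    = λ p<q → lower-closed (ℚ.neg-antimono-< p<q)
  ; lower-open      = λ {p} Up → let q , q<-p , Uq = upper-open Up in
      - q , subst (_< - q) (neg-involutive p) (ℚ.neg-antimono-< q<-p) ,
      subst (Upper x) (sym (neg-involutive q)) Uq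
  ; upper-open      = λ {q} Lq → let p , -q<p , Lp = lower-open Lq in
      - p , subst (- p <_) (neg-involutive q) (ℚ.neg-antimono-< -q<p) ,
      subst (Lower x) (sym (neg-involutive p)) Lp
  ; disjoint        = λ Uq Lq → disjoint Lq Uq
  ; located         = λ p<q → Data.Sum.swap (located (ℚ.neg-antimono-< p<q))
  }
  where open ℝ x hiding (Lower; Upper)

_·ᴿ_ : (c : ℚ) .{{_ : Positive c}} → ℝ → ℝ
_·ᴿ_ c x = record
  { Lower           = λ q → Lower x (c⁻¹ * q)
  ; Upper           = λ q → Upper x (c⁻¹ * q)
  ; lower-inhabited = let q , Lq = lower-inhabited in c * q , subst (Lower x) (sym (cancel q)) Lq
  ; upper-inhabited = let q , Uq = upper-inhabited in c * q , subst (Upper x) (sym (cancel q)) Uq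
  ; lower-closed    = λ p<q → lower-closed (ℚ.*-monoʳ-<-pos c⁻¹ p<q)
  ; upper-closed    = λ p<q → upper-closed (ℚ.*-monoʳ-<-pos c⁻¹ p<q)
  ; lower-open      = λ {p} Lp → let q , p<q , Lq = lower-open Lp in
      c * q , subst (_< c * q) (cancel′ p) (ℚ.*-monoʳ-<-pos c p<q) , subst (Lower x) (sym (cancel q)) Lq
  ; upper-open      = λ {q} Uq → let p , p<q , Up = upper-open Uq in
      c * p , subst (c * p <_) (cancel′ q) (ℚ.*-monoʳ-<-pos c p<q) , subst (Upper x) (sym (cancel p)) Up
  ; disjoint        = disjoint
  ; located         = λ p<q → located (ℚ.*-monoʳ-<-pos c⁻¹ p<q)
  }
  where
  open ℝ x hiding (Lower; Upper)
  instance
    c-nonZero : NonZero c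
    c-nonZero = ℚ.pos⇒nonZero c
  c⁻¹ = 1/ c
  instance
    c⁻¹-positive : Positive c⁻¹
    c⁻¹-positive = ℚ.1/pos⇒pos c
  cancel : ∀ q → c⁻¹ * (c * q) ≡ q
  cancel q = trans (sym (ℚ.*-assoc c⁻¹ c q)) (trans (cong (_* q) (ℚ.*-inverseˡ c)) (ℚ.*-identityˡ q))
  cancel′ : ∀ q → c * (c⁻¹ * q) ≡ q
  cancel′ q = trans (sym (ℚ.*-assoc c c⁻¹ q)) (trans (cong (_* q) (ℚ.*-inverseʳ c)) (ℚ.*-identityˡ q))

module Approximation where
  open ≡-Reasoning

  fromℕ-suc : ∀ k → fromℕ (suc k) ≡ 1ℚ + fromℕ k
  fromℕ-suc k = begin
    ℤ.+ suc k / 1                    ≡⟨ cong (_/ 1) (cong (λ z → ℤ.+ 1 ℤ.+ z) (ℤ.*-identityʳ (ℤ.+ k))) ⟨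
    1ℚ + mkℚ (ℤ.+ k) 0 (Coprime.sym (Coprime.1-coprimeTo k)) ≡⟨ cong (λ z → 1ℚ + z) (ℚ.↥p/↧p≡p (mkℚ (ℤ.+ k) 0 (Coprime.sym (Coprime.1-coprimeTo k)))) ⟨
    1ℚ + fromℕ k                     ∎

  fromℕ-suc-* : ∀ k δ → fromℕ (suc k) * δ ≡ δ + fromℕ k * δ
  fromℕ-suc-* k δ = trans (cong (_* δ) (fromℕ-suc k))
    (solve 2 (λ n δ → (con 1ℚ :+ n) :* δ := δ :+ n :* δ) refl (fromℕ k) δ)
    where open +-*-Solver

  below-natural : ∀ p → ∃ λ k → p ≤ fromℕ k
  below-natural p@(mkℚ n d c) = ℤ.∣ n ∣ ,
    subst (p ≤_) (sym (ℚ.↥p/↧p≡p (mkℚ (ℤ.+ ℤ.∣ n ∣) 0 (Coprime.sym (Coprime.1-coprimeTo ℤ.∣ n ∣)))))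
      (*≤* (n*1≤ n))
    where
    n*1≤ : ∀ n → n ℤ.* ℤ.+ 1 ℤ.≤ ℤ.+ ℤ.∣ n ∣ ℤ.* ℤ.+ suc d
    n*1≤ (ℤ.+ m)      = subst₂ ℤ._≤_ (ℤ.pos-* m 1) (ℤ.pos-* m (suc d)) (ℤ.+≤+ (ℕ.*-monoʳ-≤ m (ℕ.s≤s ℕ.z≤n)))
    n*1≤ (ℤ.-[1+ m ]) = ℤ.-≤+

  archimedean : ∀ p {δ} → 0ℚ < δ → ∃ λ k → p ≤ fromℕ k * δ
  archimedean p {δ} 0<δ = let k , le = below-natural (p * 1/ δ) in
    k , subst (_≤ fromℕ k * δ) cancel (ℚ.*-monoʳ-≤-nonNeg δ le)
    where
    instance
      δ-positive : Positive δ
      δ-positive = positive 0<δ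
      δ-nonZero : NonZero δ
      δ-nonZero = ℚ.pos⇒nonZero δ
      δ-nonNegative : NonNegative δ
      δ-nonNegative = ℚ.pos⇒nonNeg δ
    cancel : p * 1/ δ * δ ≡ p
    cancel = trans (ℚ.*-assoc p (1/ δ) δ) (trans (cong (p *_) (ℚ.*-inverseˡ δ)) (ℚ.*-identityʳ p))

  p<p+δ : ∀ p {δ} → 0ℚ < δ → p < p + δ
  p<p+δ p {δ} 0<δ = subst (_< p + δ) (ℚ.+-identityʳ p) (ℚ.+-monoʳ-< p 0<δ)

  module _ (x : ℝ) where
    open ℝ x hiding (Lower; Upper)

    walk : ∀ k {δ a} → 0ℚ < δ → Lower x a → Upper x (a + fromℕ k * δ) →
           ∃ λ b → Lower x b × Upper x (b + (δ + δ))
    walk zero    {δ} {a} 0<δ La U = ⊥-elim (disjoint La (subst (Upper x)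
      (trans (cong (a +_) (ℚ.*-zeroˡ δ)) (ℚ.+-identityʳ a)) U))
    walk (suc k) {δ} {a} 0<δ La U with located (ℚ.+-monoʳ-< a (p<p+δ δ 0<δ))
    ... | inj₂ U′ = a , La , U′
    ... | inj₁ L′ = walk k 0<δ L′ (subst (Upper x)
      (trans (cong (a +_) (fromℕ-suc-* k δ)) (sym (ℚ.+-assoc a δ (fromℕ k * δ)))) U)

    approximate : ∀ {δ} → 0ℚ < δ → ∃ λ b → Lower x b × Upper x (b + (δ + δ))
    approximate {δ} 0<δ =
      let a , La = lower-inhabited
          u , Uu = upper-inhabited
          k , le = archimedean (u - a + δ) 0<δ
          u<end = ℚ.<-≤-trans (p<p+δ u 0<δ)
            (subst (_≤ a + fromℕ k * δ)
              (solve 3 (λ u a δ → a :+ (u :- a :+ δ) := u :+ δ) refl u a δ)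
              (ℚ.+-monoʳ-≤ a le))
      in walk k 0<δ La (upper-closed u<end Uu)
      where open +-*-Solver

_+ᴿ_ : ℝ → ℝ → ℝ
x +ᴿ y = record
  { Lower           = λ q → ∃₂ λ r s → Lower x r × Lower y s × q ≡ r + s
  ; Upper           = λ q → ∃₂ λ r s → Upper x r × Upper y s × q ≡ r + s
  ; lower-inhabited = let r , Lr = X.lower-inhabited ; s , Ls = Y.lower-inhabited in
      r + s , r , s , Lr , Ls , refl
  ; upper-inhabited = let r , Ur = X.upper-inhabited ; s , Us = Y.upper-inhabited in
      r + s , r , s , Ur , Us , refl
  ; lower-closed    = λ { {p} p<q (r , s , Lr , Ls , refl) →
      r , p - r , Lr ,
      Y.lower-closed (subst (p - r <_) (cancel r s) (ℚ.+-monoˡ-< (- r) p<q)) Ls ,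
      sym (restore p r) }
  ; upper-closed    = λ { {p} {q} p<q (r , s , Ur , Us , refl) →
      r , q - r , Ur ,
      Y.upper-closed (subst (_< q - r) (cancel r s) (ℚ.+-monoˡ-< (- r) p<q)) Us ,
      sym (restore q r) }
  ; lower-open      = λ { (r , s , Lr , Ls , refl) → let r′ , r<r′ , Lr′ = X.lower-open Lr in
      r′ + s , ℚ.+-monoˡ-< s r<r′ , r′ , s , Lr′ , Ls , refl }
  ; upper-open      = λ { (r , s , Ur , Us , refl) → let r′ , r′<r , Ur′ = X.upper-open Ur in
      r′ + s , ℚ.+-monoˡ-< s r′<r , r′ , s , Ur′ , Us , refl }
  ; disjoint        = λ { (r , s , Lr , Ls , q≡r+s) (r′ , s′ , Ur′ , Us′ , q≡r′+s′) →
      ℚ.<-irrefl (trans (sym q≡r+s) q≡r′+s′)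
        (ℚ.+-mono-< (X.lower<upper Lr Ur′) (Y.lower<upper Ls Us′)) }
  ; located         = loc
  }
  where
  module X = ℝ x
  module Y = ℝ y
  open +-*-Solver
  cancel : ∀ r s → r + s - r ≡ s
  cancel = solve 2 (λ r s → r :+ s :- r := s) refl
  restore : ∀ p r → r + (p - r) ≡ p
  restore = solve 2 (λ p r → r :+ (p :- r) := p) refl

  half-positive : ∀ {p m} → p < m → 0ℚ < (m - p) * ½
  half-positive {p} {m} p<m = subst (_< (m - p) * ½) (ℚ.*-zeroˡ ½)
    (ℚ.*-monoˡ-<-pos ½ (subst (_< m - p) (ℚ.+-inverseʳ p) (ℚ.+-monoˡ-< (- p) p<m)))
  gap : ∀ {p q m} b → m < q → p - b < q - (b + ((m - p) * ½ + (m - p) * ½))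
  gap {p} {q} {m} b m<q = subst (_< q - (b + ((m - p) * ½ + (m - p) * ½)))
    (solve 3 (λ m p b → m :- (b :+ ((m :- p) :* con ½ :+ (m :- p) :* con ½)) := p :- b) refl m p b)
    (ℚ.+-monoˡ-< (- (b + ((m - p) * ½ + (m - p) * ½))) m<q)

  loc : ∀ {p q} → p < q → (∃₂ λ r s → Lower x r × Lower y s × p ≡ r + s) ⊎
                          (∃₂ λ r s → Upper x r × Upper y s × q ≡ r + s)
  loc {p} {q} p<q =
    let m , p<m , m<q = ℚ.<-dense p<q
        b , Lb , Ub = Approximation.approximate x (half-positive p<m)
    in Data.Sum.map
         (λ L → b , p - b , Lb , L , sym (restore p b))
         (λ U → _ , _ , Ub , U , sym (restore q (b + ((m - p) * ½ + (m - p) * ½))))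
         (Y.located (gap b m<q))

_-ᴿ_ : ℝ → ℝ → ℝ
x -ᴿ y = x +ᴿ (-ᴿ y)

{-# OPTIONS --safe #-}

-- Two estimates are combined. First, sr + 2α ≥ 2n − 2c with c = m − n + 1: list the vertices so that each one
-- except the first has a neighbour earlier in the list, and repeatedly discard the newest vertex x. If x has no
-- neighbour left, it joins an independent set; if it has exactly one, y, then x joins the independent set, the pair
-- {x, y} enlarges a nonsingular principal minor of the skew-adjacency matrix, and y is discarded too; if it has
-- d ≥ 2 neighbours, discarding it destroys d − 1 ≥ 1 of the c surplus edges. Second, an independent set of size α
-- spans no edges, so α(α − 1) ≤ n(n − 1) − 2m, that is, α − ½ ≤ √(n(n − 1) − 2m + ¼).
--
-- In case of equality, substituting the second relation into the first with s = n − α leaves s ≤ 1 or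
-- s = 2, α = 1. By connectedness the graph is then a star or a triangle.
module Submission where

open import Defs
open import Algebra.Bundles using (CommutativeRing)
import Algebra.Properties.Semiring.Sum as SemiringSum
open import Data.Bool using (Bool; true; false; not; _∧_; T; T?)
open import Data.Empty using (⊥-elim)
open import Data.Fin using (Fin; zero; suc; toℕ)
import Data.Fin.Permutation as Permutation
import Data.Fin.Properties as Fin
open import Data.Fin.Subset using (Subset; ∣_∣; ⁅_⁆; _∪_; ∁; ⊤) renaming (_∈_ to _∈ₛ_; _∉_ to _∉ₛ_; ⊥ to ∅)
import Data.Fin.Subset.Properties as Subset
open import Data.Integer using (+_)
open import Data.List using (List; []; _∷_; _++_; length; filterᵇ; cartesianProduct; allFin; tabulate; map)
import Data.List.Properties as List
open import Data.List.Membership.Propositional using (_∈_; _∉_)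
open import Data.List.Membership.Propositional.Properties using (∈-++⁻; ∈-++⁺ʳ; ∈-∃++; ∈-allFin)
open import Data.List.Relation.Binary.Permutation.Propositional as ↭ using (_↭_; prep; swap; ↭-refl; ↭-sym; ↭-trans; ↭-reflexive; ↭⇒↭ₛ)
open import Data.List.Relation.Binary.Permutation.Propositional.Properties using (↭-length; ∈-resp-↭; shift; ++⁺ˡ)
open import Data.List.Relation.Binary.Permutation.Setoid.Properties using (Unique-resp-↭)
open import Data.List.Relation.Binary.Sublist.Propositional using (_⊆_; []; _∷_; _∷ʳ_; ⊆-refl) renaming (lookup to ⊆-lookup)
open import Data.List.Relation.Binary.Sublist.Propositional.Properties using (All-resp-⊆)
open import Data.List.Relation.Unary.All as All using (All; []; _∷_)
open import Data.List.Relation.Unary.AllPairs using (AllPairs; []; _∷_)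
import Data.List.Relation.Unary.AllPairs.Properties as AllPairs
open import Data.List.Relation.Unary.Any using (here; there)
open import Data.List.Relation.Unary.Unique.Propositional using (Unique)
import Data.List.Relation.Unary.Unique.Propositional.Properties as Unique
open import Data.Nat as ℕ using (ℕ; zero; suc; z≤n; s≤s)
import Data.Nat.Properties as ℕ
import Data.Nat.Solver as ℕ-Solver
open import Data.Product using (∃; ∃₂; _×_; _,_; proj₁; proj₂; uncurry)
open import Data.Rational using (ℚ; 0ℚ; 1ℚ; ½; -_; _+_; _-_; _*_; _/_; 1/_; _≤_; _<_; NonZero; Positive; NonNegative; positive; nonNegative)
import Data.Rational.Properties as ℚ
import Data.Rational.Solver as ℚ-Solver
open import Data.Sum using (_⊎_; inj₁; inj₂; [_,_]′; map₂)
open import Data.Unit using (tt)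
open import Data.Vec as Vec using (Vec; []; _∷_)
import Data.Vec.Properties as Vec
open import Function using (_∘_; _⇔_; mk⇔; _↔_; Inverse; Injection)
open import Function.Construct.Identity using (↔-id)
open import Function.Properties.Inverse using (↔⇒↣)
open import Relation.Binary.Construct.Closure.ReflexiveTransitive using (Star; ε; _◅_)
open import Relation.Binary.PropositionalEquality using (_≡_; _≢_; refl; sym; trans; cong; cong₂; subst; subst₂; setoid; module ≡-Reasoning)
open import Relation.Nullary using (¬_; Dec; yes; no; does; contradiction; ¬?)
open import Relation.Nullary.Decidable using (decidable-stable; dec-true; dec-false)

open SemiringSum (CommutativeRing.semiring ℚ.+-*-commutativeRing) using (sum)

-- Counting in lists and subsets.

bit : Bool → ℕ
bit false = 0
bit true  = 1

module _ {A : Set} where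

  count : (A → Bool) → List A → ℕ
  count f []       = 0
  count f (x ∷ xs) = bit (f x) ℕ.+ count f xs

  pairs : (A → A → Bool) → List A → ℕ
  pairs h []       = 0
  pairs h (x ∷ xs) = count (h x) xs ℕ.+ pairs h xs

  length-filterᵇ : ∀ (f : A → Bool) xs → length (filterᵇ f xs) ≡ count f xs
  length-filterᵇ f []       = refl
  length-filterᵇ f (x ∷ xs) with f x
  ... | true  = cong suc (length-filterᵇ f xs)
  ... | false = length-filterᵇ f xs

  count-++ : ∀ (f : A → Bool) xs ys → count f (xs ++ ys) ≡ count f xs ℕ.+ count f ys
  count-++ f []       ys = refl
  count-++ f (x ∷ xs) ys = trans (cong (bit (f x) ℕ.+_) (count-++ f xs ys)) (sym (ℕ.+-assoc (bit (f x)) _ _))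

  count-↭ : ∀ (f : A → Bool) {xs ys} → xs ↭ ys → count f xs ≡ count f ys
  count-↭ f ↭.refl        = refl
  count-↭ f (prep x p)    = cong (bit (f x) ℕ.+_) (count-↭ f p)
  count-↭ f {ys = _ ∷ _ ∷ ys} (swap x y p) = trans (cong (λ z → bit (f x) ℕ.+ (bit (f y) ℕ.+ z)) (count-↭ f p))
    (solve 3 (λ a b c → a :+ (b :+ c) := b :+ (a :+ c)) refl (bit (f x)) (bit (f y)) (count f ys))
    where open ℕ-Solver.+-*-Solver
  count-↭ f (↭.trans p q) = trans (count-↭ f p) (count-↭ f q)

  -- A swap replaces `h x y` by `h y x`, which is where symmetry enters. Edges can therefore be
  -- counted along any ordering of the vertices.
  pairs-↭ : ∀ {h : A → A → Bool} → (∀ x y → h x y ≡ h y x) → ∀ {xs ys} → xs ↭ ys → pairs h xs ≡ pairs h ys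
  pairs-↭ h-sym ↭.refl        = refl
  pairs-↭ {h} h-sym (prep x p)    = cong₂ ℕ._+_ (count-↭ (h x) p) (pairs-↭ h-sym p)
  pairs-↭ {h} h-sym {ys = _ ∷ _ ∷ ys} (swap x y p)
    rewrite h-sym x y | count-↭ (h x) p | count-↭ (h y) p | pairs-↭ h-sym p =
    solve 4 (λ b c d e → b :+ c :+ (d :+ e) := b :+ d :+ (c :+ e)) refl (bit (h y x)) (count (h x) ys) (count (h y) ys) (pairs h ys)
    where open ℕ-Solver.+-*-Solver
  pairs-↭ h-sym (↭.trans p q) = trans (pairs-↭ h-sym p) (pairs-↭ h-sym q)

  count-⊆ : ∀ (f : A → Bool) {xs ys} → xs ⊆ ys → count f xs ℕ.≤ count f ys
  count-⊆ f []         = z≤n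
  count-⊆ f (y ∷ʳ s)   = ℕ.≤-trans (count-⊆ f s) (ℕ.m≤n+m _ (bit (f y)))
  count-⊆ f (refl ∷ s) = ℕ.+-monoʳ-≤ _ (count-⊆ f s)

  AllPairs-⊆ : ∀ {R : A → A → Set} {xs ys} → xs ⊆ ys → AllPairs R ys → AllPairs R xs
  AllPairs-⊆ []         []         = []
  AllPairs-⊆ (y ∷ʳ s)   (_ ∷ Rys)  = AllPairs-⊆ s Rys
  AllPairs-⊆ (refl ∷ s) (Ry ∷ Rys) = All-resp-⊆ s Ry ∷ AllPairs-⊆ s Rys

  count-positive : ∀ {f : A → Bool} {x xs} → x ∈ xs → T (f x) → 0 ℕ.< count f xs
  count-positive {f} {x} (here refl) fx with f x
  ... | true = s≤s z≤n
  count-positive {f} {xs = y ∷ _} (there x∈) fx = ℕ.≤-trans (count-positive x∈ fx) (ℕ.m≤n+m _ (bit (f y)))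

  count≡0⇒¬ : ∀ {f : A → Bool} {xs} → count f xs ≡ 0 → ∀ {x} → x ∈ xs → ¬ T (f x)
  count≡0⇒¬ eq x∈ fx = ℕ.<⇒≢ (count-positive x∈ fx) (sym eq)

  -- Applied with `f = adj G x`: `point` is the only neighbour of `x` in the list, and `others` is
  -- what remains once it is discarded.
  record UniqueSolution (f : A → Bool) (xs : List A) : Set where
    field
      point       : A
      others      : List A
      point∈      : point ∈ xs
      holds       : T (f point)
      others⊆     : others ⊆ xs
      length-eq   : length xs ≡ suc (length others)
      others-fail : count f others ≡ 0

  uniqueSolution : ∀ (f : A → Bool) xs → count f xs ≡ 1 → UniqueSolution f xs
  uniqueSolution f (x ∷ xs) eq with f x in fx
  ... | true  = record
    { point = x ; others = xs ; point∈ = here refl ; holds = subst T (sym fx) tt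
    ; others⊆ = x ∷ʳ ⊆-refl ; length-eq = refl ; others-fail = ℕ.suc-injective eq }
  ... | false = let open UniqueSolution (uniqueSolution f xs eq) in record
    { point = point ; others = x ∷ others ; point∈ = there point∈ ; holds = holds
    ; others⊆ = refl ∷ others⊆ ; length-eq = cong suc length-eq
    ; others-fail = trans (cong (λ b → bit b ℕ.+ count f others) fx) others-fail }

  -- The number of edges that have to be removed to make every vertex of the list adjacent to at most one
  -- later vertex; it plays the role of the cyclomatic number and, unlike it, ignores connected components.
  excess : (A → A → Bool) → List A → ℕ
  excess h []       = 0
  excess h (x ∷ xs) = (count (h x) xs ℕ.∸ 1) ℕ.+ excess h xs

  -- Each vertex that is kept has no more later neighbours than before, and truncated subtraction is
  -- monotone. This permits discarding the neighbour of a pendant vertex.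
  excess-⊆ : ∀ (h : A → A → Bool) {xs ys} → xs ⊆ ys → excess h xs ℕ.≤ excess h ys
  excess-⊆ h []         = z≤n
  excess-⊆ h (y ∷ʳ s)   = ℕ.≤-trans (excess-⊆ h s) (ℕ.m≤n+m _ _)
  excess-⊆ h (refl ∷ s) = ℕ.+-mono-≤ (ℕ.∸-monoˡ-≤ 1 (count-⊆ (h _) s)) (excess-⊆ h s)

  count-disjoint : ∀ (f g : A → Bool) → (∀ x → T (f x) → ¬ T (g x)) → ∀ xs → count f xs ℕ.+ count g xs ℕ.≤ length xs
  count-disjoint f g disj []       = z≤n
  count-disjoint f g disj (x ∷ xs) with f x | g x | disj x
  ... | true  | true  | d = ⊥-elim (d tt tt)
  ... | true  | false | _ = s≤s (count-disjoint f g disj xs)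
  ... | false | true  | _ = subst (ℕ._≤ suc (length xs)) (sym (ℕ.+-suc _ _)) (s≤s (count-disjoint f g disj xs))
  ... | false | false | _ = ℕ.m≤n⇒m≤1+n (count-disjoint f g disj xs)

  count-false : ∀ (xs : List A) → count (λ _ → false) xs ≡ 0
  count-false []       = refl
  count-false (x ∷ xs) = count-false xs

-- The binomial coefficient `k` choose 2.
triangular : ℕ → ℕ
triangular zero    = 0
triangular (suc k) = k ℕ.+ triangular k

2*triangular : ∀ k → 2 ℕ.* triangular k ℕ.+ k ≡ k ℕ.* k
2*triangular zero    = refl
2*triangular (suc k) = trans
  (solve 2 (λ k t → con 2 :* (k :+ t) :+ (con 1 :+ k) := (con 2 :* t :+ k) :+ (con 1 :+ con 2 :* k)) refl k (triangular k))
  (trans (cong (ℕ._+ (1 ℕ.+ 2 ℕ.* k)) (2*triangular k))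
    (solve 1 (λ k → k :* k :+ (con 1 :+ con 2 :* k) := (con 1 :+ k) :* (con 1 :+ k)) refl k))
  where open ℕ-Solver.+-*-Solver

module _ {A : Set} where

  pairs-square : ∀ (f : A → Bool) xs → pairs (λ x y → f x ∧ f y) xs ≡ triangular (count f xs)
  pairs-square f []       = refl
  pairs-square f (x ∷ xs) with f x
  ... | true  = cong (count f xs ℕ.+_) (pairs-square f xs)
  ... | false = cong₂ ℕ._+_ (count-false xs) (pairs-square f xs)

  -- Each pair of positions contributes to at most one of the two counts. It is applied to the edges
  -- and to the pairs inside an independent set.
  pairs-disjoint : ∀ (h k : A → A → Bool) → (∀ x y → T (h x y) → ¬ T (k x y)) →
                   ∀ xs → pairs h xs ℕ.+ pairs k xs ℕ.≤ triangular (length xs)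
  pairs-disjoint h k disj []       = z≤n
  pairs-disjoint h k disj (x ∷ xs) = subst (ℕ._≤ length xs ℕ.+ triangular (length xs))
    (solve 4 (λ a b c d → (a :+ b) :+ (c :+ d) := (a :+ c) :+ (b :+ d)) refl
       (count (h x) xs) (count (k x) xs) (pairs h xs) (pairs k xs))
    (ℕ.+-mono-≤ (count-disjoint (h x) (k x) (disj x) xs) (pairs-disjoint h k disj xs))
    where open ℕ-Solver.+-*-Solver

count-tabulate : ∀ {n} {A : Set} (f : A → Bool) (p : Subset n) (g : Fin n → A) →
                 (∀ i → f (g i) ≡ Vec.lookup p i) → count f (tabulate g) ≡ ∣ p ∣
count-tabulate f []          g eq = refl
count-tabulate f (true ∷ p)  g eq = cong₂ ℕ._+_ (cong bit (eq zero)) (count-tabulate f p (g ∘ suc) (eq ∘ suc))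
count-tabulate f (false ∷ p) g eq = cong₂ ℕ._+_ (cong bit (eq zero)) (count-tabulate f p (g ∘ suc) (eq ∘ suc))

∣p∪⁅x⁆∣ : ∀ {n} {p : Subset n} {x} → x ∉ₛ p → suc ∣ p ∣ ℕ.≤ ∣ p ∪ ⁅ x ⁆ ∣
∣p∪⁅x⁆∣ {p = p} {x} x∉p = Subset.p⊂q⇒∣p∣<∣q∣
  (Subset.p⊆p∪q ⁅ x ⁆ , x , Subset.q⊆p∪q p ⁅ x ⁆ (Subset.x∈⁅x⁆ x) , x∉p)

∈-p∪⁅x⁆ : ∀ {n} (p : Subset n) x {y} → y ∈ₛ p ∪ ⁅ x ⁆ → y ∈ₛ p ⊎ y ≡ x
∈-p∪⁅x⁆ p x y∈ = map₂ (Subset.x∈⁅y⁆⇒x≡y x) (Subset.x∈p∪q⁻ p ⁅ x ⁆ y∈)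

¬T⇒≡false : ∀ {b} → ¬ T b → b ≡ false
¬T⇒≡false {false} _  = refl
¬T⇒≡false {true}  ¬t = contradiction tt ¬t

T⇒≡true : ∀ {b} → T b → b ≡ true
T⇒≡true {true} _ = refl

-- The number of edges, and the pair count for an independent set.

module _ {n} (G : Graph n) where

  private
    upward : Fin n → Fin n → Bool
    upward x y = (toℕ x ℕ.<ᵇ toℕ y) ∧ adj G x y

    ¬<⇒not-upward : ∀ {x y} → ¬ toℕ x ℕ.< toℕ y → upward x y ≡ false
    ¬<⇒not-upward {x} {y} x≮y with toℕ x ℕ.<ᵇ toℕ y in eq
    ... | true  = contradiction (ℕ.<ᵇ⇒< (toℕ x) (toℕ y) (subst T (sym eq) tt)) x≮y
    ... | false = refl

    <⇒upward : ∀ {x y} → toℕ x ℕ.< toℕ y → upward x y ≡ adj G x y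
    <⇒upward {x} {y} x<y with toℕ x ℕ.<ᵇ toℕ y in eq
    ... | true  = refl
    ... | false = ⊥-elim (subst T eq (ℕ.<⇒<ᵇ x<y))

    productCount : List (Fin n) → List (Fin n) → ℕ
    productCount xs ys = count (uncurry upward) (cartesianProduct xs ys)

    count-map : ∀ x ys → count (uncurry upward) (map (x ,_) ys) ≡ count (upward x) ys
    count-map x []       = refl
    count-map x (y ∷ ys) = cong (bit (upward x y) ℕ.+_) (count-map x ys)

    productCount-∷ : ∀ x xs ys → productCount (x ∷ xs) ys ≡ count (upward x) ys ℕ.+ productCount xs ys
    productCount-∷ x xs ys = trans (count-++ (uncurry upward) (map (x ,_) ys) _)
      (cong (ℕ._+ productCount xs ys) (count-map x ys))

    count-upward : ∀ {x xs} → All (λ y → toℕ x ℕ.< toℕ y) xs → count (upward x) xs ≡ count (adj G x) xs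
    count-upward []         = refl
    count-upward (x<y ∷ xs) = cong₂ ℕ._+_ (cong bit (<⇒upward x<y)) (count-upward xs)

    -- A pair is counted only if it ascends, so a second coordinate below all of `ys` adds nothing.
    productCount-drop : ∀ {x} ys {xs} → All (λ y → toℕ x ℕ.< toℕ y) ys → productCount ys (x ∷ xs) ≡ productCount ys xs
    productCount-drop []                _            = refl
    productCount-drop {x} (y ∷ ys) {xs} (x<y ∷ x<ys) = begin
      productCount (y ∷ ys) (x ∷ xs)
        ≡⟨ productCount-∷ y ys (x ∷ xs) ⟩
      bit (upward y x) ℕ.+ count (upward y) xs ℕ.+ productCount ys (x ∷ xs)
        ≡⟨ cong₂ (λ b c → bit b ℕ.+ count (upward y) xs ℕ.+ c) (¬<⇒not-upward (ℕ.<-asym x<y)) (productCount-drop ys x<ys) ⟩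
      count (upward y) xs ℕ.+ productCount ys xs
        ≡⟨ productCount-∷ y ys xs ⟨
      productCount (y ∷ ys) xs ∎
      where open ≡-Reasoning

    productCount-sorted : ∀ {xs} → AllPairs (λ x y → toℕ x ℕ.< toℕ y) xs → productCount xs xs ≡ pairs (adj G) xs
    productCount-sorted []                           = refl
    productCount-sorted {x ∷ xs} (x<xs ∷ sorted) = begin
      productCount (x ∷ xs) (x ∷ xs)
        ≡⟨ productCount-∷ x xs (x ∷ xs) ⟩
      bit (upward x x) ℕ.+ count (upward x) xs ℕ.+ productCount xs (x ∷ xs)
        ≡⟨ cong₂ (λ b c → bit b ℕ.+ count (upward x) xs ℕ.+ c) (¬<⇒not-upward {x} {x} (ℕ.<-irrefl refl)) (productCount-drop xs x<xs) ⟩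
      count (upward x) xs ℕ.+ productCount xs xs
        ≡⟨ cong₂ ℕ._+_ (count-upward x<xs) (productCount-sorted sorted) ⟩
      count (adj G x) xs ℕ.+ pairs (adj G) xs ∎
      where open ≡-Reasoning

  -- Since `allFin n` is increasing, the ascending pairs of the full square are those in which the
  -- first entry precedes the second. Unlike `size`, the right-hand side can be followed along
  -- permutations and split at the head of a list.
  size≡pairs : size G ≡ pairs (adj G) (allFin n)
  size≡pairs = trans (length-filterᵇ (uncurry upward) (cartesianProduct (allFin n) (allFin n)))
    (productCount-sorted (AllPairs.tabulate⁺-< λ i<j → i<j))

  independent≤α : ∀ {p} → Independent G p → ∣ p ∣ ℕ.≤ α G
  independent≤α {p} ind = proj₂ (proj₂ (independence-number-exists G)) ∣ p ∣ (p , ind , refl)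

  maximumIndependentSet : ∃ λ p → Independent G p × ∣ p ∣ ≡ α G
  maximumIndependentSet = proj₁ (proj₂ (independence-number-exists G))

  -- No edge lies inside `p`, so edges and pairs inside `p` are disjoint families among all `n`
  -- choose 2 pairs. The inequality between the counts is doubled and freed of subtraction.
  independent-pairs : ∀ {p} → Independent G p → ∣ p ∣ ℕ.* ∣ p ∣ ℕ.+ n ℕ.+ 2 ℕ.* size G ℕ.≤ n ℕ.* n ℕ.+ ∣ p ∣
  independent-pairs {p} ind = begin
    a ℕ.* a ℕ.+ n ℕ.+ 2 ℕ.* size G
      ≡⟨ cong (λ z → z ℕ.+ n ℕ.+ 2 ℕ.* size G) (2*triangular a) ⟨
    2 ℕ.* triangular a ℕ.+ a ℕ.+ n ℕ.+ 2 ℕ.* size G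
      ≡⟨ solve 4 (λ t a n m → con 2 :* t :+ a :+ n :+ con 2 :* m := con 2 :* (m :+ t) :+ (n :+ a)) refl
           (triangular a) a n (size G) ⟩
    2 ℕ.* (size G ℕ.+ triangular a) ℕ.+ (n ℕ.+ a)
      ≤⟨ ℕ.+-monoˡ-≤ (n ℕ.+ a) (ℕ.*-monoʳ-≤ 2 bound) ⟩
    2 ℕ.* triangular n ℕ.+ (n ℕ.+ a)
      ≡⟨ ℕ.+-assoc (2 ℕ.* triangular n) n a ⟨
    2 ℕ.* triangular n ℕ.+ n ℕ.+ a
      ≡⟨ cong (ℕ._+ a) (2*triangular n) ⟩
    n ℕ.* n ℕ.+ a ∎
    where
    open ℕ.≤-Reasoning
    open ℕ-Solver.+-*-Solver
    a = ∣ p ∣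
    inside² : Fin n → Fin n → Bool
    inside² x y = Vec.lookup p x ∧ Vec.lookup p y
    ∧-split : ∀ {b c} → T (b ∧ c) → b ≡ true × c ≡ true
    ∧-split {true} {true} _ = refl , refl
    disjoint : ∀ x y → T (adj G x y) → ¬ T (inside² x y)
    disjoint x y xy in² = let xp , yp = ∧-split in² in
      ind x y (Vec.lookup⇒[]= x p xp) (Vec.lookup⇒[]= y p yp) xy
    bound : size G ℕ.+ triangular a ℕ.≤ triangular n
    bound = subst₂ ℕ._≤_
      (cong₂ ℕ._+_ (sym size≡pairs)
        (trans (pairs-square (Vec.lookup p) (allFin n))
               (cong triangular (count-tabulate (Vec.lookup p) p (λ i → i) λ _ → refl))))
      (cong triangular (List.length-tabulate {n = n} λ i → i))
      (pairs-disjoint (adj G) inside² disjoint (allFin n))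

  -- Enlarging independent sets; vertex orderings of a connected graph.

  Adjacent-sym : ∀ {x y} → Adjacent G x y → Adjacent G y x
  Adjacent-sym {x} {y} = subst T (adj-sym G x y)

  Adjacent-irrefl : ∀ {x} → ¬ Adjacent G x x
  Adjacent-irrefl {x} xx = subst T (no-loop G x) xx

  independent-∪ : ∀ {p x} → Independent G p → (∀ {y} → y ∈ₛ p → ¬ Adjacent G x y) → Independent G (p ∪ ⁅ x ⁆)
  independent-∪ {p} {x} ind x-free y z y∈ z∈ yz with ∈-p∪⁅x⁆ p x y∈ | ∈-p∪⁅x⁆ p x z∈
  ... | inj₁ y∈p  | inj₁ z∈p  = ind y z y∈p z∈p yz
  ... | inj₁ y∈p  | inj₂ refl = x-free y∈p (Adjacent-sym yz)
  ... | inj₂ refl | inj₁ z∈p  = x-free z∈p yz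
  ... | inj₂ refl | inj₂ refl = Adjacent-irrefl yz

  independent-∅ : Independent G ∅
  independent-∅ x _ x∈∅ = contradiction x∈∅ Subset.∉⊥

  -- The newest vertex stands at the head: every vertex except the last in the list has a neighbour
  -- further down. Such a list is built by exploring a connected graph from its last entry.
  data Attached : List (Fin n) → Set where
    [_] : ∀ x → Attached (x ∷ [])
    _∷_ : ∀ {x L} → 0 ℕ.< count (adj G x) L → Attached L → Attached (x ∷ L)

  -- A vertex with `d ≥ 1` later neighbours adds `d − 1` to the excess, 1 to the length and `d` to
  -- the edges; attachment makes the truncated subtraction exact. The starting vertex accounts for
  -- the 1. For a full list the excess is thus the cyclomatic number `m − n + 1`.
  attached-excess : ∀ {L} → Attached L → excess (adj G) L ℕ.+ length L ≡ suc (pairs (adj G) L)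
  attached-excess [ x ] = refl
  attached-excess {x ∷ L} (0<d ∷ att) with count (adj G x) L
  attached-excess {x ∷ L} (s≤s _ ∷ att) | suc d = trans
    (solve 3 (λ d e l → d :+ e :+ (con 1 :+ l) := con 1 :+ d :+ (e :+ l)) refl d (excess (adj G) L) (length L))
    (trans (cong (suc d ℕ.+_) (attached-excess att)) (ℕ.+-suc (suc d) _))
    where open ℕ-Solver.+-*-Solver

  Exhaustive : List (Fin n) → Set
  Exhaustive L = L ↭ allFin n

  unique : ∀ {L} → Exhaustive L → Unique L
  unique L↭ = Unique-resp-↭ (setoid (Fin n)) (↭⇒↭ₛ (↭-sym L↭)) (Unique.allFin⁺ n)

  private
    ++-disjoint : ∀ L {R} → Unique (L ++ R) → ∀ {x : Fin n} → x ∈ L → x ∉ R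
    ++-disjoint (x ∷ L) (x∉ ∷ _) (here refl) x∈R = All.lookup x∉ (∈-++⁺ʳ L x∈R) refl
    ++-disjoint (x ∷ L) (_ ∷ u)  (there x∈L) x∈R = ++-disjoint L u x∈L x∈R

    -- Follow the walk until its first step out of `L`. It cannot end before that, because no vertex
    -- lies in both `L` and `R`.
    crossing-edge : ∀ {L R} → Exhaustive (L ++ R) → ∀ {x y} → Star (Adjacent G) x y → x ∈ L → y ∈ R →
                    ∃₂ λ u v → u ∈ L × v ∈ R × Adjacent G u v
    crossing-edge {L} full ε x∈L x∈R = ⊥-elim (++-disjoint L (unique full) x∈L x∈R)
    crossing-edge {L} full (_◅_ {j = z} xz walk) x∈L y∈R with ∈-++⁻ L (∈-resp-↭ (↭-sym full) (∈-allFin z))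
    ... | inj₁ z∈L = crossing-edge full walk z∈L y∈R
    ... | inj₂ z∈R = _ , z , x∈L , z∈R , xz

    -- `R` holds the vertices not yet reached. A walk from `x` to one of them crosses into `R`, and
    -- the vertex at which it arrives is attached next. The recursion runs on the length `k`, since
    -- `R₁ ++ R₂` is not a structural part of the old `R`.
    grow : Connected G → ∀ k x L R → length R ≡ k → Exhaustive (x ∷ L ++ R) → Attached (x ∷ L) →
           ∃ λ L′ → Exhaustive L′ × Attached L′
    grow conn k x L [] len full att = x ∷ L , subst (λ M → Exhaustive (x ∷ M)) (List.++-identityʳ L) full , att
    grow conn (suc k) x L (r ∷ R) len full att
      with u , v , u∈ , v∈ , uv ← crossing-edge {x ∷ L} full (proj₂ conn x r) (here refl) (here refl)
      with R₁ , R₂ , eq ← ∈-∃++ v∈ =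
      grow conn k v (x ∷ L) (R₁ ++ R₂) (ℕ.suc-injective (trans (sym (↭-length R↭)) len))
        (↭-trans (↭-sym (shift v (x ∷ L) (R₁ ++ R₂))) (↭-trans (++⁺ˡ (x ∷ L) (↭-sym R↭)) full))
        (count-positive u∈ (Adjacent-sym uv) ∷ att)
      where
      R↭ : r ∷ R ↭ v ∷ R₁ ++ R₂
      R↭ = ↭-trans (↭-reflexive eq) (shift v R₁ R₂)

  connected-ordering : Connected G → ∃ λ L → Exhaustive L × Attached L
  connected-ordering conn = start n refl
    where
    start : ∀ k → n ≡ k → ∃ λ L → Exhaustive L × Attached L
    start zero    refl = contradiction (proj₁ conn) λ ()
    start (suc k) refl = grow conn _ zero [] (tabulate suc) refl ↭-refl [ zero ]

  module Ordering (conn : Connected G) where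

    private ordering = connected-ordering conn

    vertices = proj₁ ordering

    exhaustive : Exhaustive vertices
    exhaustive = proj₁ (proj₂ ordering)

    length≡n : length vertices ≡ n
    length≡n = trans (↭-length exhaustive) (List.length-tabulate {n = n} λ i → i)

    excess+n : excess (adj G) vertices ℕ.+ n ≡ suc (size G)
    excess+n = begin
      excess (adj G) vertices ℕ.+ n
        ≡⟨ cong (excess (adj G) vertices ℕ.+_) length≡n ⟨
      excess (adj G) vertices ℕ.+ length vertices
        ≡⟨ attached-excess (proj₂ (proj₂ ordering)) ⟩
      suc (pairs (adj G) vertices)
        ≡⟨ cong suc (trans (pairs-↭ (adj-sym G) exhaustive) (sym size≡pairs)) ⟩
      suc (size G) ∎
      where open ≡-Reasoning

  -- The cyclomatic number is not negative.
  connected-size : Connected G → n ℕ.≤ suc (size G)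
  connected-size conn = subst (n ℕ.≤_) excess+n (ℕ.m≤n+m n _)
    where open Ordering conn

-- The lower bound for the skew-rank in terms of the independence number.

module _ {n} {G : Graph n} (σ : Orientation G) where

  private
    S : Matrix n n
    S = skewAdjacency σ

    _~_ : Fin n → Fin n → Set
    _~_ = Adjacent G

  skew-nonadjacent : ∀ {x y} → ¬ x ~ y → S x y ≡ 0ℚ
  skew-nonadjacent {x} {y} x≁y with arc σ x y in xy | arc σ y x in yx
  ... | true  | _     = contradiction (arc-adjacent σ x y (subst T (sym xy) tt)) x≁y
  ... | false | true  = contradiction (Adjacent-sym G (arc-adjacent σ y x (subst T (sym yx) tt))) x≁y
  ... | false | false = refl

  skew-adjacent : ∀ {x y} → x ~ y → S x y ≢ 0ℚ
  skew-adjacent {x} {y} x~y with arc σ x y in xy | arc σ y x in yx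
  ... | true  | _     = λ ()
  ... | false | true  = λ ()
  ... | false | false = λ _ → [ subst T xy , subst T yx ]′ (arc-total σ x y x~y)

  columns : ∀ {k} → Vec (Fin n) k → Fin k → Fin n → ℚ
  columns J j i = S i (Vec.lookup J j)

  independent≤sr : ∀ {k} (J : Vec (Fin n) k) → LinearlyIndependent (columns J) → k ℕ.≤ sr σ
  independent≤sr {k} J indep = proj₂ (proj₂ (rank-exists S)) k (J , indep)

  Nonsingular : ∀ {k} → Vec (Fin n) k → Set
  Nonsingular J = LinearlyIndependent λ j i → S (Vec.lookup J i) (Vec.lookup J j)

  -- A relation between full columns holds in particular in the rows of `J`.
  nonsingular≤sr : ∀ {k} (J : Vec (Fin n) k) → Nonsingular J → k ℕ.≤ sr σ
  nonsingular≤sr J ns = independent≤sr J λ c cS≡0 → ns c (cS≡0 ∘ Vec.lookup J)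

  -- In row x only column y is nonzero, so the coefficient of y vanishes; then those of J do, by the rows of J; then
  -- that of x, by row y.
  nonsingular-pendant : ∀ {k x y} (J : Vec (Fin n) k) → x ~ y → (∀ j → ¬ x ~ Vec.lookup J j) →
                        Nonsingular J → Nonsingular (x ∷ y ∷ J)
  nonsingular-pendant {k} {x} {y} J x~y x≁J ns c cS≡0 = λ where
      zero          → cx≡0
      (suc zero)    → cy≡0
      (suc (suc j)) → cJ≡0 j
    where
    open ≡-Reasoning
    open Elimination using (sum-zero; *-cancel-zero)
    cx = c zero
    cy = c (suc zero)
    cJ : Fin k → ℚ
    cJ j = c (suc (suc j))
    combination : Fin n → ℚ
    combination i = sum λ j → cJ j * S i (Vec.lookup J j)

    times-zero : ∀ {p q} → q ≡ 0ℚ → p * q ≡ 0ℚ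
    times-zero {p} refl = ℚ.*-zeroʳ p
    zero-times : ∀ {p q} → p ≡ 0ℚ → p * q ≡ 0ℚ
    zero-times {q = q} refl = ℚ.*-zeroˡ q

    cy≡0 : cy ≡ 0ℚ
    cy≡0 = *-cancel-zero cy (S x y) (skew-adjacent x~y) (begin
      cy * S x y
        ≡⟨ trans (ℚ.+-identityˡ _) (ℚ.+-identityʳ _) ⟨
      0ℚ + (cy * S x y + 0ℚ)
        ≡⟨ cong₂ (λ a b → a + (cy * S x y + b))
             (times-zero {cx} (skew-nonadjacent (Adjacent-irrefl G)))
             (sum-zero λ j → times-zero {cJ j} (skew-nonadjacent (x≁J j))) ⟨
      cx * S x x + (cy * S x y + combination x)
        ≡⟨ cS≡0 zero ⟩
      0ℚ ∎)

    cJ≡0 : ∀ j → cJ j ≡ 0ℚ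
    cJ≡0 = ns cJ λ j → let i = Vec.lookup J j in begin
      combination i
        ≡⟨ trans (ℚ.+-identityˡ _) (ℚ.+-identityˡ _) ⟨
      0ℚ + (0ℚ + combination i)
        ≡⟨ cong₂ (λ a b → a + (b + combination i))
             (times-zero {cx} (skew-nonadjacent (x≁J j ∘ Adjacent-sym G)))
             (zero-times {q = S i y} cy≡0) ⟨
      cx * S i x + (cy * S i y + combination i)
        ≡⟨ cS≡0 (suc (suc j)) ⟩
      0ℚ ∎

    cx≡0 : cx ≡ 0ℚ
    cx≡0 = *-cancel-zero cx (S y x) (skew-adjacent (Adjacent-sym G x~y)) (begin
      cx * S y x
        ≡⟨ ℚ.+-identityʳ _ ⟨
      cx * S y x + (0ℚ + 0ℚ)
        ≡⟨ cong₂ (λ a b → cx * S y x + (a + b))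
             (zero-times {q = S y y} cy≡0)
             (sum-zero λ j → zero-times {q = S y (Vec.lookup J j)} (cJ≡0 j)) ⟨
      cx * S y x + (cy * S y y + combination y)
        ≡⟨ cS≡0 (suc zero) ⟩
      0ℚ ∎)

  -- The invariant of the vertex-by-vertex deletion: `large` is the bound `2n ≤ sr + 2α + 2c` for
  -- the list, with explicit witnesses in place of `sr` and `α`. Both witnesses stay inside `L`, so
  -- a vertex without neighbours in `L` is adjacent to neither.
  record Decomposition (L : List (Fin n)) : Set where
    field
      free         : Subset n
      free∈        : ∀ {x} → x ∈ₛ free → x ∈ L
      independent  : Independent G free
      {rank-bound} : ℕ
      minor        : Vec (Fin n) rank-bound
      minor∈       : ∀ j → Vec.lookup minor j ∈ L
      nonsingular  : Nonsingular minor
      large        : 2 ℕ.* length L ℕ.≤ rank-bound ℕ.+ 2 ℕ.* ∣ free ∣ ℕ.+ 2 ℕ.* excess (adj G) L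

  private
    -- The recursion runs on a bound for the length, because a pendant vertex is removed together
    -- with a neighbour from anywhere in the list.
    decompose : ∀ k L → length L ℕ.≤ k → Unique L → Decomposition L
    decompose _ [] _ _ = record
      { free = ∅ ; free∈ = λ x∈∅ → contradiction x∈∅ Subset.∉⊥ ; independent = independent-∅ G
      ; minor = [] ; minor∈ = λ () ; nonsingular = λ _ _ () ; large = z≤n }
    decompose (suc k) (x ∷ L) (s≤s len) (x∉L ∷ uniq) with count (adj G x) L in d
    -- One vertex adds 2 to the left of `large`; the larger independent set pays for it.
    ... | zero = record
      { free        = free ∪ ⁅ x ⁆
      ; free∈       = λ z∈ → [ there ∘ free∈ , (λ { refl → here refl }) ]′ (∈-p∪⁅x⁆ free x z∈)
      ; independent = independent-∪ G independent (count≡0⇒¬ d ∘ free∈)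
      ; minor       = minor
      ; minor∈      = there ∘ minor∈
      ; nonsingular = nonsingular
      ; large       = begin
          2 ℕ.* suc (length L)
            ≡⟨ ℕ.*-suc 2 (length L) ⟩
          2 ℕ.+ 2 ℕ.* length L
            ≤⟨ ℕ.+-monoʳ-≤ 2 large ⟩
          2 ℕ.+ (rank-bound ℕ.+ 2 ℕ.* ∣ free ∣ ℕ.+ 2 ℕ.* e)
            ≡⟨ solve 3 (λ r f e → con 2 :+ (r :+ con 2 :* f :+ con 2 :* e) := r :+ con 2 :* (con 1 :+ f) :+ con 2 :* e)
                 refl rank-bound ∣ free ∣ e ⟩
          rank-bound ℕ.+ 2 ℕ.* suc ∣ free ∣ ℕ.+ 2 ℕ.* e
            ≤⟨ ℕ.+-monoˡ-≤ _ (ℕ.+-monoʳ-≤ rank-bound (ℕ.*-monoʳ-≤ 2 (∣p∪⁅x⁆∣ x∉free))) ⟩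
          rank-bound ℕ.+ 2 ℕ.* ∣ free ∪ ⁅ x ⁆ ∣ ℕ.+ 2 ℕ.* e
            ≡⟨ cong (λ z → rank-bound ℕ.+ 2 ℕ.* ∣ free ∪ ⁅ x ⁆ ∣ ℕ.+ 2 ℕ.* ((z ℕ.∸ 1) ℕ.+ e)) d ⟨
          rank-bound ℕ.+ 2 ℕ.* ∣ free ∪ ⁅ x ⁆ ∣ ℕ.+ 2 ℕ.* excess (adj G) (x ∷ L) ∎
      }
      where
      open ℕ.≤-Reasoning
      open ℕ-Solver.+-*-Solver
      open Decomposition (decompose k L len uniq)
      e = excess (adj G) L
      x∉free : x ∉ₛ free
      x∉free x∈ = All.lookup x∉L (free∈ x∈) refl
    -- Two vertices add 4: the minor pays 2 and the independent set pays 2. Every vertex of `others`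
    -- is nonadjacent to `x`, as both enlargements require.
    ... | suc zero = record
      { free        = free ∪ ⁅ x ⁆
      ; free∈       = λ z∈ → [ there ∘ ⊆-lookup others⊆ ∘ free∈ , (λ { refl → here refl }) ]′ (∈-p∪⁅x⁆ free x z∈)
      ; independent = independent-∪ G independent (count≡0⇒¬ others-fail ∘ free∈)
      ; minor       = x ∷ point ∷ minor
      ; minor∈      = λ { zero → here refl ; (suc zero) → there point∈ ; (suc (suc j)) → there (⊆-lookup others⊆ (minor∈ j)) }
      ; nonsingular = nonsingular-pendant minor holds (λ j → count≡0⇒¬ others-fail (minor∈ j)) nonsingular
      ; large       = begin
          2 ℕ.* suc (length L)
            ≡⟨ cong (λ l → 2 ℕ.* suc l) length-eq ⟩
          2 ℕ.* suc (suc (length others))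
            ≡⟨ solve 1 (λ l → con 2 :* (con 2 :+ l) := con 4 :+ con 2 :* l) refl (length others) ⟩
          4 ℕ.+ 2 ℕ.* length others
            ≤⟨ ℕ.+-monoʳ-≤ 4 large ⟩
          4 ℕ.+ (rank-bound ℕ.+ 2 ℕ.* ∣ free ∣ ℕ.+ 2 ℕ.* excess (adj G) others)
            ≡⟨ solve 3 (λ r f e → con 4 :+ (r :+ con 2 :* f :+ con 2 :* e) := con 2 :+ r :+ con 2 :* (con 1 :+ f) :+ con 2 :* e)
                 refl rank-bound ∣ free ∣ (excess (adj G) others) ⟩
          2 ℕ.+ rank-bound ℕ.+ 2 ℕ.* suc ∣ free ∣ ℕ.+ 2 ℕ.* excess (adj G) others
            ≤⟨ ℕ.+-mono-≤ (ℕ.+-monoʳ-≤ (2 ℕ.+ rank-bound) (ℕ.*-monoʳ-≤ 2 (∣p∪⁅x⁆∣ x∉free)))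
                          (ℕ.*-monoʳ-≤ 2 (excess-⊆ (adj G) others⊆)) ⟩
          2 ℕ.+ rank-bound ℕ.+ 2 ℕ.* ∣ free ∪ ⁅ x ⁆ ∣ ℕ.+ 2 ℕ.* e
            ≡⟨ cong (λ z → 2 ℕ.+ rank-bound ℕ.+ 2 ℕ.* ∣ free ∪ ⁅ x ⁆ ∣ ℕ.+ 2 ℕ.* ((z ℕ.∸ 1) ℕ.+ e)) d ⟨
          2 ℕ.+ rank-bound ℕ.+ 2 ℕ.* ∣ free ∪ ⁅ x ⁆ ∣ ℕ.+ 2 ℕ.* excess (adj G) (x ∷ L) ∎
      }
      where
      open ℕ.≤-Reasoning
      open ℕ-Solver.+-*-Solver
      open UniqueSolution (uniqueSolution (adj G x) L d)
      open Decomposition (decompose k others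
        (ℕ.≤-trans (ℕ.n≤1+n _) (subst (ℕ._≤ k) length-eq len)) (AllPairs-⊆ others⊆ uniq))
      e = excess (adj G) L
      x∉free : x ∉ₛ free
      x∉free x∈ = All.lookup x∉L (⊆-lookup others⊆ (free∈ x∈)) refl
    -- The excess falls by `1 + d′`, and twice its first unit already pays for the vertex.
    ... | suc (suc d′) = record
      { free = free ; free∈ = there ∘ free∈ ; independent = independent
      ; minor = minor ; minor∈ = there ∘ minor∈ ; nonsingular = nonsingular
      ; large = begin
          2 ℕ.* suc (length L)
            ≡⟨ ℕ.*-suc 2 (length L) ⟩
          2 ℕ.+ 2 ℕ.* length L
            ≤⟨ ℕ.+-monoʳ-≤ 2 large ⟩
          2 ℕ.+ (rank-bound ℕ.+ 2 ℕ.* ∣ free ∣ ℕ.+ 2 ℕ.* e)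
            ≤⟨ ℕ.m≤m+n _ (2 ℕ.* d′) ⟩
          2 ℕ.+ (rank-bound ℕ.+ 2 ℕ.* ∣ free ∣ ℕ.+ 2 ℕ.* e) ℕ.+ 2 ℕ.* d′
            ≡⟨ solve 4 (λ r f e d → con 2 :+ (r :+ con 2 :* f :+ con 2 :* e) :+ con 2 :* d :=
                                    r :+ con 2 :* f :+ con 2 :* (con 1 :+ d :+ e))
                 refl rank-bound ∣ free ∣ e d′ ⟩
          rank-bound ℕ.+ 2 ℕ.* ∣ free ∣ ℕ.+ 2 ℕ.* (suc d′ ℕ.+ e)
            ≡⟨ cong (λ z → rank-bound ℕ.+ 2 ℕ.* ∣ free ∣ ℕ.+ 2 ℕ.* ((z ℕ.∸ 1) ℕ.+ e)) d ⟨
          rank-bound ℕ.+ 2 ℕ.* ∣ free ∣ ℕ.+ 2 ℕ.* excess (adj G) (x ∷ L) ∎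
      }
      where
      open ℕ.≤-Reasoning
      open ℕ-Solver.+-*-Solver
      open Decomposition (decompose k L len uniq)
      e = excess (adj G) L

  -- Adding `2n` to both sides of `large` lets `excess+n` replace the excess by the number of edges.
  rank-independence-bound : Connected G → 4 ℕ.* n ℕ.≤ sr σ ℕ.+ 2 ℕ.* α G ℕ.+ 2 ℕ.* suc (size G)
  rank-independence-bound conn = begin
    4 ℕ.* n
      ≡⟨ solve 1 (λ n → con 4 :* n := con 2 :* n :+ con 2 :* n) refl n ⟩
    2 ℕ.* n ℕ.+ 2 ℕ.* n
      ≡⟨ cong (λ l → 2 ℕ.* l ℕ.+ 2 ℕ.* n) length≡n ⟨
    2 ℕ.* length vertices ℕ.+ 2 ℕ.* n
      ≤⟨ ℕ.+-monoˡ-≤ (2 ℕ.* n) large ⟩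
    rank-bound ℕ.+ 2 ℕ.* ∣ free ∣ ℕ.+ 2 ℕ.* e ℕ.+ 2 ℕ.* n
      ≤⟨ ℕ.+-monoˡ-≤ (2 ℕ.* n) (ℕ.+-monoˡ-≤ (2 ℕ.* e)
           (ℕ.+-mono-≤ (nonsingular≤sr minor nonsingular) (ℕ.*-monoʳ-≤ 2 (independent≤α G independent)))) ⟩
    sr σ ℕ.+ 2 ℕ.* α G ℕ.+ 2 ℕ.* e ℕ.+ 2 ℕ.* n
      ≡⟨ solve 4 (λ r a e n → r :+ con 2 :* a :+ con 2 :* e :+ con 2 :* n := r :+ con 2 :* a :+ con 2 :* (e :+ n))
           refl (sr σ) (α G) e n ⟩
    sr σ ℕ.+ 2 ℕ.* α G ℕ.+ 2 ℕ.* (e ℕ.+ n)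
      ≡⟨ cong (λ z → sr σ ℕ.+ 2 ℕ.* α G ℕ.+ 2 ℕ.* z) excess+n ⟩
    sr σ ℕ.+ 2 ℕ.* α G ℕ.+ 2 ℕ.* suc (size G) ∎
    where
    open ℕ.≤-Reasoning
    open ℕ-Solver.+-*-Solver
    open Ordering G conn
    open Decomposition (decompose _ vertices ℕ.≤-refl (unique G exhaustive))
    e = excess (adj G) vertices

-- Arithmetic of the equality case.

classify : ∀ n a m r → a ℕ.≤ n → 1 ℕ.≤ a → (2 ℕ.≤ n → 1 ℕ.≤ r) → n ℕ.≤ suc m →
           n ℕ.* n ℕ.+ a ≡ a ℕ.* a ℕ.+ n ℕ.+ 2 ℕ.* m →
           r ℕ.+ 2 ℕ.* a ℕ.+ 2 ℕ.* suc m ℕ.≤ 4 ℕ.* n →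
           n ≡ 1 ⊎ n ≡ suc a ⊎ (n ≡ 3 × a ≡ 1)
classify n (suc b) m r a≤n (s≤s z≤n) 2≤n⇒1≤r n≤1+m pairs-eq rank-le
  with s , refl ← ℕ.m≤n⇒∃[o]m+o≡n a≤n = cases s refl
  where
  open ℕ-Solver.+-*-Solver
  a = suc b
  cases : ∀ s′ → s′ ≡ s → n ≡ 1 ⊎ n ≡ suc a ⊎ (n ≡ 3 × a ≡ 1)
  -- If `a = n`, then `pairs-eq` leaves no edges, and `n ≤ suc m` leaves a single vertex.
  cases zero refl = inj₁ (ℕ.≤-antisym (subst (λ m → n ℕ.≤ suc m) m≡0 n≤1+m) (s≤s z≤n))
    where
    m≡0 : m ≡ 0
    m≡0 = ℕ.m+n≡0⇒m≡0 m (sym (ℕ.+-cancelˡ-≡ (a ℕ.* a ℕ.+ a) 0 (2 ℕ.* m)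
      (trans (solve 1 (λ a → a :* a :+ a :+ con 0 := (a :+ con 0) :* (a :+ con 0) :+ a) refl a)
        (trans pairs-eq (solve 2 (λ a m → a :* a :+ (a :+ con 0) :+ con 2 :* m := a :* a :+ a :+ con 2 :* m) refl a m)))))
  cases (suc zero) refl = inj₂ (inj₁ (ℕ.+-comm a 1))
  cases (suc (suc t)) refl = inj₂ (inj₂ (small b t r bound (2≤n⇒1≤r (s≤s (ℕ.≤-trans (s≤s z≤n) (ℕ.m≤n+m (2 ℕ.+ t) b))))))
    where
    -- Here `a = 1 + b` and `n = a + 2 + t`. Once `pairs-eq` has eliminated `2m` from `rank-le`,
    -- both sides contain `rest`, which is cancelled.
    rest = 14 ℕ.+ b ℕ.* b ℕ.+ 7 ℕ.* b ℕ.+ 5 ℕ.* t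
    bound : r ℕ.+ (t ℕ.+ t ℕ.* t ℕ.+ 2 ℕ.* b ℕ.+ 2 ℕ.* (b ℕ.* t)) ℕ.≤ 2
    bound = ℕ.+-cancelʳ-≤ rest _ _ (subst₂ ℕ._≤_
      (trans (cong (r ℕ.+ 2 ℕ.* a ℕ.+ 2 ℕ.+_) (sym pairs-eq))
        (solve 3 (λ r b t → let a = con 1 :+ b ; n = a :+ (con 2 :+ t) in
            r :+ con 2 :* a :+ con 2 :+ (n :* n :+ a) :=
            r :+ (t :+ t :* t :+ con 2 :* b :+ con 2 :* (b :* t)) :+ (con 14 :+ b :* b :+ con 7 :* b :+ con 5 :* t))
          refl r b t))
      (solve 2 (λ b t → let a = con 1 :+ b ; n = a :+ (con 2 :+ t) in
          con 4 :* n :+ (a :* a :+ n) := con 2 :+ (con 14 :+ b :* b :+ con 7 :* b :+ con 5 :* t)) refl b t)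
      (subst (ℕ._≤ 4 ℕ.* n ℕ.+ (a ℕ.* a ℕ.+ n))
        (solve 4 (λ r a m n → r :+ con 2 :* a :+ con 2 :* (con 1 :+ m) :+ (a :* a :+ n) :=
                              r :+ con 2 :* a :+ con 2 :+ (a :* a :+ n :+ con 2 :* m)) refl r a m n)
        (ℕ.+-monoˡ-≤ (a ℕ.* a ℕ.+ n) rank-le)))
    -- As `r ≥ 1`, the other terms sum to at most 1. But `t + t²` is at least 2 when `t ≥ 1`, and
    -- `2b` is at least 2 when `b ≥ 1`.
    small : ∀ b t r → r ℕ.+ (t ℕ.+ t ℕ.* t ℕ.+ 2 ℕ.* b ℕ.+ 2 ℕ.* (b ℕ.* t)) ℕ.≤ 2 → 1 ℕ.≤ r →
            suc b ℕ.+ (2 ℕ.+ t) ≡ 3 × suc b ≡ 1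
    small zero    zero    r       _   _ = refl , refl
    small (suc b) zero    (suc r) le  _ = contradiction
      (ℕ.≤-trans (ℕ.≤-reflexive (solve 1 (λ b → con 2 :+ con 2 :* b := con 2 :* (con 1 :+ b)) refl b))
        (ℕ.≤-trans (ℕ.m≤m+n _ (2 ℕ.* (suc b ℕ.* 0))) (ℕ.≤-trans (ℕ.m≤n+m _ r) (ℕ.≤-pred le)))) λ { (s≤s ()) }
    small b       (suc t) (suc r) le  _ = contradiction
      (ℕ.≤-trans (s≤s (ℕ.≤-trans (s≤s z≤n) (ℕ.m≤n+m (suc (t ℕ.+ t ℕ.* suc t)) t)))
        (ℕ.≤-trans (ℕ.m≤m+n _ (2 ℕ.* b)) (ℕ.≤-trans (ℕ.m≤m+n _ (2 ℕ.* (b ℕ.* suc t))) (ℕ.≤-trans (ℕ.m≤n+m _ r) (ℕ.≤-pred le)))))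
      λ { (s≤s ()) }

-- Recognising stars and triangles.

module _ {n} (G : Graph n) where

  private
    _~_ : Fin n → Fin n → Set
    _~_ = Adjacent G

  -- A star described inside `G`, without a choice of isomorphism. On one vertex both conditions are
  -- vacuous.
  record StarCentre (c : Fin n) : Set where
    field
      leaves : ∀ {x y} → x ≢ c → y ≢ c → ¬ x ~ y
      spokes : ∀ {x} → x ≢ c → c ~ x

  Complete : Set
  Complete = ∀ {x y} → x ≢ y → x ~ y

  first-edge : ∀ {x y} → x ≢ y → Star _~_ x y → ∃ λ z → x ~ z
  first-edge x≢y ε        = contradiction refl x≢y
  first-edge x≢y (xz ◅ _) = _ , xz

  some-edge : Connected G → 2 ℕ.≤ n → ∃₂ _~_
  some-edge (_ , walk) (s≤s (s≤s _)) = zero , first-edge (λ ()) (walk zero (suc zero))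

  independent-⁅x⁆ : ∀ x → Independent G ⁅ x ⁆
  independent-⁅x⁆ x y z y∈ z∈ yz with refl ← Subset.x∈⁅y⁆⇒x≡y x y∈ | refl ← Subset.x∈⁅y⁆⇒x≡y x z∈ =
    Adjacent-irrefl G yz

  α-positive : 0 ℕ.< n → 1 ℕ.≤ α G
  α-positive (s≤s z≤n) = subst (ℕ._≤ α G) (Subset.∣⁅x⁆∣≡1 v) (independent≤α G (independent-⁅x⁆ v))
    where
    v : Fin n
    v = zero

  -- Two distinct nonadjacent vertices would form an independent set of size 2.
  α≡1⇒complete : α G ≡ 1 → Complete
  α≡1⇒complete α≡1 {x} {y} x≢y = decidable-stable (T? (adj G x y)) λ x≁y →
    ℕ.1+n≰n (begin
      2                     ≡⟨ cong suc (Subset.∣⁅x⁆∣≡1 x) ⟨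
      suc ∣ ⁅ x ⁆ ∣         ≤⟨ ∣p∪⁅x⁆∣ (λ y∈ → x≢y (sym (Subset.x∈⁅y⁆⇒x≡y x y∈))) ⟩
      ∣ ⁅ x ⁆ ∪ ⁅ y ⁆ ∣     ≤⟨ independent≤α G (independent-∪ G (independent-⁅x⁆ x)
                                 λ z∈ yz → x≁y (Adjacent-sym G (subst (y ~_) (Subset.x∈⁅y⁆⇒x≡y x z∈) yz))) ⟩
      α G                   ≡⟨ α≡1 ⟩
      1                     ∎)
    where open ℕ.≤-Reasoning

  -- A maximum independent set omits exactly one vertex `c`: omitting none would give it `n`
  -- elements, and omitting two would make `n` at least `α G + 2`. Any other vertex has a neighbour
  -- by connectedness, and that neighbour can only be `c`.
  n≡1+α⇒star : Connected G → n ≡ suc (α G) → ∃ StarCentre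
  n≡1+α⇒star (_ , walk) n≡1+α with p , ind , ∣p∣≡α ← maximumIndependentSet G = find (Fin.any? λ x → ¬? (x Subset.∈? p))
    where
    open ℕ.≤-Reasoning
    find : Dec (∃ λ c → c ∉ₛ p) → ∃ StarCentre
    find (no none) = contradiction (begin
        suc (α G)     ≡⟨ n≡1+α ⟨
        n             ≡⟨ Subset.∣⊤∣≡n n ⟨
        ∣ ⊤ {n} ∣     ≤⟨ Subset.p⊆q⇒∣p∣≤∣q∣ {p = ⊤} (λ {x} _ → decidable-stable (x Subset.∈? p) λ x∉p → none (x , x∉p)) ⟩
        ∣ p ∣         ≡⟨ ∣p∣≡α ⟩
        α G           ∎) ℕ.1+n≰n
    find (yes (c , c∉p)) = c , record
      { leaves = λ x≢c y≢c → ind _ _ (others∈p x≢c) (others∈p y≢c)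
      ; spokes = λ {x} x≢c → let y , x~y = first-edge x≢c (walk x c) in
          Adjacent-sym G (subst (x ~_)
            (decidable-stable (y Fin.≟ c) λ y≢c → ind _ _ (others∈p x≢c) (others∈p y≢c) x~y) x~y)
      }
      where
      others∈p : ∀ {x} → x ≢ c → x ∈ₛ p
      others∈p {x} x≢c = decidable-stable (x Subset.∈? p) λ x∉p → ℕ.1+n≰n (begin
        suc n                     ≡⟨ cong suc n≡1+α ⟩
        2 ℕ.+ α G                 ≡⟨ cong (2 ℕ.+_) ∣p∣≡α ⟨
        2 ℕ.+ ∣ p ∣               ≤⟨ s≤s (∣p∪⁅x⁆∣ c∉p) ⟩
        suc ∣ p ∪ ⁅ c ⁆ ∣         ≤⟨ ∣p∪⁅x⁆∣ (λ x∈ → [ x∉p , x≢c ]′ (∈-p∪⁅x⁆ p c x∈)) ⟩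
        ∣ (p ∪ ⁅ c ⁆) ∪ ⁅ x ⁆ ∣   ≤⟨ Subset.∣p∣≤n ((p ∪ ⁅ c ⁆) ∪ ⁅ x ⁆) ⟩
        n                         ∎)

n≡1⇒star : ∀ (G : Graph 1) → StarCentre G zero
n≡1⇒star G = record
  { leaves = λ { {zero} 0≢0 → contradiction refl 0≢0 } ; spokes = λ { {zero} 0≢0 → contradiction refl 0≢0 } }

-- For distinct vertices, adjacency in a star depends only on whether one of them is the centre, so
-- any permutation that matches the centres is an isomorphism.
centre-to-zero⇒≅ : ∀ {n} (G : Graph (suc n)) {c} → StarCentre G c →
                   (π : Fin (suc n) ↔ Fin (suc n)) → Inverse.to π c ≡ zero → G ≅ star (suc n)
centre-to-zero⇒≅ {n} G {c} centre π to-c = π , same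
  where
  open StarCentre centre
  to = Inverse.to π
  to-leaf : ∀ {x} → x ≢ c → ∃ λ y → to x ≡ suc y
  to-leaf {x} x≢c with to x in eq
  ... | zero  = contradiction (Injection.injective (↔⇒↣ π) (trans eq (sym to-c))) x≢c
  ... | suc y = y , refl
  same : ∀ x y → adj G x y ≡ adj (star (suc n)) (to x) (to y)
  same x y with x Fin.≟ c | y Fin.≟ c
  ... | yes refl | yes refl = trans (no-loop G x) (sym (no-loop (star (suc n)) (to x)))
  ... | yes refl | no y≢c with _ , eq ← to-leaf y≢c rewrite to-c | eq = T⇒≡true (spokes y≢c)
  ... | no x≢c | yes refl with _ , eq ← to-leaf x≢c rewrite to-c | eq = T⇒≡true (Adjacent-sym G (spokes x≢c))
  ... | no x≢c | no y≢c with _ , eq ← to-leaf x≢c | _ , eq′ ← to-leaf y≢c rewrite eq | eq′ = ¬T⇒≡false (leaves x≢c y≢c)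

StarCentre⇒≅ : ∀ {n} (G : Graph n) {c} → StarCentre G c → G ≅ star n
StarCentre⇒≅ {suc n} G {c} centre = centre-to-zero⇒≅ G centre (Permutation.transpose c zero) to-c
  where
  to-c : Permutation.transpose c zero Permutation.⟨$⟩ʳ c ≡ zero
  to-c rewrite dec-true (c Fin.≟ c) refl = refl

≅⇒StarCentre : ∀ {n} (G : Graph (suc n)) → G ≅ star (suc n) → ∃ (StarCentre G)
≅⇒StarCentre {n} G (f , same) = c , record { leaves = leaf ; spokes = spoke }
  where
  open Inverse f using (to; from)
  c = from zero
  to-c : to c ≡ zero
  to-c = Inverse.strictlyInverseˡ f zero
  to-leaf : ∀ {x} → x ≢ c → ∃ λ y → to x ≡ suc y
  to-leaf {x} x≢c with to x in eq
  ... | zero  = contradiction (Injection.injective (↔⇒↣ f) (trans eq (sym to-c))) x≢c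
  ... | suc y = y , refl
  leaf : ∀ {x y} → x ≢ c → y ≢ c → ¬ Adjacent G x y
  leaf {x} {y} x≢c y≢c xy with _ , eq ← to-leaf x≢c | _ , eq′ ← to-leaf y≢c =
    subst T (trans (same x y) (cong₂ (adj (star (suc n))) eq eq′)) xy
  spoke : ∀ {x} → x ≢ c → Adjacent G c x
  spoke {x} x≢c with _ , eq ← to-leaf x≢c =
    subst T (sym (trans (same c x) (cong₂ (adj (star (suc n))) to-c eq))) tt

Complete⇒≅ : ∀ (G : Graph 3) → Complete G → G ≅ triangle
Complete⇒≅ G complete = ↔-id _ , same
  where
  same : ∀ x y → adj G x y ≡ not (does (x Fin.≟ y))
  same x y with x Fin.≟ y
  ... | yes refl = no-loop G x
  ... | no x≢y   = T⇒≡true (complete x≢y)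

≅⇒Complete : ∀ {n} (G : Graph n) → G ≅ triangle → Complete G
≅⇒Complete G (f , same) {x} {y} x≢y = subst T (sym (trans (same x y)
  (cong not (dec-false (to x Fin.≟ to y) (x≢y ∘ Injection.injective (↔⇒↣ f)))))) tt
  where open Inverse f using (to)

-- With the three entries above the diagonal known, `size` evaluates.
Complete-size : ∀ (G : Graph 3) → Complete G → size G ≡ 3
Complete-size G complete
  rewrite T⇒≡true (complete {zero} {suc zero} λ ())
        | T⇒≡true (complete {zero} {suc (suc zero)} λ ())
        | T⇒≡true (complete {suc zero} {suc (suc zero)} λ ()) = refl

-- The skew-rank of edgeless graphs, stars and triangles.

module _ {n} {G : Graph n} (σ : Orientation G) where

  private
    S : Matrix n n
    S = skewAdjacency σ

  skew-antisym : ∀ x y → S x y ≡ - S y x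
  skew-antisym x y with arc σ x y in xy | arc σ y x in yx
  ... | true  | true  = contradiction (subst T (sym yx) tt) (arc-asym σ x y (subst T (sym xy) tt))
  ... | true  | false = refl
  ... | false | true  = refl
  ... | false | false = refl

  edge⇒2≤sr : ∀ {x y} → Adjacent G x y → 2 ℕ.≤ sr σ
  edge⇒2≤sr {x} {y} x~y = nonsingular≤sr σ (x ∷ y ∷ []) (nonsingular-pendant σ [] x~y (λ ()) λ _ _ ())

  Dependent : Fin n → Fin n → Fin n → Set
  Dependent x y z = ∃ λ a → ∃₂ λ b d →
    (a ≢ 0ℚ ⊎ b ≢ 0ℚ) × (∀ i → a * S i x + (b * S i y + d * S i z) ≡ 0ℚ)

  private
    maximal-columns : ∃ λ (J : Vec (Fin n) (sr σ)) → LinearlyIndependent (columns σ J)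
    maximal-columns = proj₁ (proj₂ (rank-exists S))

  -- Independent columns have distinct indices, so among three or more of them the first three
  -- satisfy a relation; extended by zero coefficients, it contradicts independence.
  sr≤2 : (∀ {x y z} → x ≢ y → x ≢ z → y ≢ z → Dependent x y z) → sr σ ℕ.≤ 2
  sr≤2 dependent = bound (proj₁ maximal-columns) (proj₂ maximal-columns)
    where
    bound : ∀ {k} (J : Vec (Fin n) k) → LinearlyIndependent (columns σ J) → k ℕ.≤ 2
    bound []           _ = z≤n
    bound (_ ∷ [])     _ = s≤s z≤n
    bound (_ ∷ _ ∷ []) _ = s≤s (s≤s z≤n)
    bound {suc (suc (suc k))} J@(x ∷ y ∷ z ∷ J′) indep = ⊥-elim (refute (dependent
      (λ eq → contradiction (distinct {zero} {suc zero} eq) λ ())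
      (λ eq → contradiction (distinct {zero} {suc (suc zero)} eq) λ ())
      (λ eq → contradiction (distinct {suc zero} {suc (suc zero)} eq) λ ())))
      where
      distinct : ∀ {i j} → Vec.lookup J i ≡ Vec.lookup J j → i ≡ j
      distinct = Elimination.independent-injective S (Vec.lookup J) indep
      refute : ¬ Dependent x y z
      refute (a , b , d , nontrivial , relation) =
        [ (λ a≢0 → a≢0 (indep c vanishes zero)) , (λ b≢0 → b≢0 (indep c vanishes (suc zero))) ]′ nontrivial
        where
        c : Fin (suc (suc (suc k))) → ℚ
        c zero                = a
        c (suc zero)          = b
        c (suc (suc zero))    = d
        c (suc (suc (suc _))) = 0ℚ
        vanishes : ∀ i → sum (λ j → c j * S i (Vec.lookup J j)) ≡ 0ℚ
        vanishes i = trans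
          (cong (λ e → a * S i x + (b * S i y + (d * S i z + e)))
            (Elimination.sum-zero λ j → ℚ.*-zeroˡ (S i (Vec.lookup J′ j))))
          (trans (cong (λ e → a * S i x + (b * S i y + e)) (ℚ.+-identityʳ (d * S i z))) (relation i))

  edgeless⇒sr≡0 : (∀ {x y} → ¬ Adjacent G x y) → sr σ ≡ 0
  edgeless⇒sr≡0 none = bound (proj₁ maximal-columns) (proj₂ maximal-columns)
    where
    bound : ∀ {k} (J : Vec (Fin n) k) → LinearlyIndependent (columns σ J) → k ≡ 0
    bound []      _     = refl
    bound (x ∷ J) indep = contradiction
      (indep (λ _ → 1ℚ) (λ i → Elimination.sum-zero λ j → trans (ℚ.*-identityˡ (columns σ (x ∷ J) j i)) (skew-nonadjacent σ {i} {Vec.lookup (x ∷ J) j} none)) zero) λ ()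

  star-sr≤2 : ∀ {c} → StarCentre G c → sr σ ℕ.≤ 2
  star-sr≤2 {c} centre = sr≤2 dependent
    where
    open StarCentre centre
    open ℚ-Solver.+-*-Solver
    -- The columns of two leaves vanish outside row `c`, hence are proportional.
    leaf-relation : ∀ {x y} → x ≢ c → y ≢ c → ∀ i → S c y * S i x + - S c x * S i y ≡ 0ℚ
    leaf-relation {x} {y} x≢c y≢c i with i Fin.≟ c
    ... | yes refl = solve 2 (λ p q → q :* p :+ (:- p) :* q := con 0ℚ) refl (S c x) (S c y)
    ... | no i≢c   = trans
      (cong₂ (λ p q → S c y * p + - S c x * q) (skew-nonadjacent σ (leaves i≢c x≢c)) (skew-nonadjacent σ (leaves i≢c y≢c)))
      (solve 2 (λ p q → q :* con 0ℚ :+ (:- p) :* con 0ℚ := con 0ℚ) refl (S c x) (S c y))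
    dependent : ∀ {x y z} → x ≢ y → x ≢ z → y ≢ z → Dependent x y z
    -- At least two of the three vertices are leaves; their relation is used, with coefficient 0 on
    -- the third.
    dependent {x} {y} {z} x≢y x≢z y≢z with x Fin.≟ c | y Fin.≟ c
    ... | yes refl | _ = 0ℚ , S c z , - S c y , inj₂ (skew-adjacent σ (spokes (x≢z ∘ sym))) , λ i →
      trans (solve 2 (λ p q → con 0ℚ :* p :+ q := q) refl (S i x) (S c z * S i y + - S c y * S i z))
            (leaf-relation (x≢y ∘ sym) (x≢z ∘ sym) i)
    ... | no x≢c | yes refl = S c z , 0ℚ , - S c x , inj₁ (skew-adjacent σ (spokes (y≢z ∘ sym))) , λ i →
      trans (solve 3 (λ p q r → p :+ (con 0ℚ :* q :+ r) := p :+ r) refl (S c z * S i x) (S i y) (- S c x * S i z))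
            (leaf-relation x≢c (y≢z ∘ sym) i)
    ... | no x≢c | no y≢c = S c y , - S c x , 0ℚ , inj₁ (skew-adjacent σ (spokes y≢c)) , λ i →
      trans (solve 3 (λ p q r → p :+ (q :+ con 0ℚ :* r) := p :+ q) refl (S c y * S i x) (- S c x * S i y) (S i z))
            (leaf-relation x≢c y≢c i)

-- A skew-symmetric matrix of order 3 annihilates the vector of its own entries
-- `(S y z, S z x, S x y)`, as a cross product `v × v` vanishes.
triangle-sr≤2 : ∀ {G : Graph 3} (σ : Orientation G) → Complete G → sr σ ℕ.≤ 2
triangle-sr≤2 {G} σ complete = sr≤2 σ λ {x} {y} {z} x≢y x≢z y≢z →
  S y z , S z x , S x y , inj₁ (skew-adjacent σ (complete y≢z)) , relation x≢y x≢z y≢z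
  where
  open ℚ-Solver.+-*-Solver
  S = skewAdjacency σ
  S-irrefl : ∀ x → S x x ≡ 0ℚ
  S-irrefl x = skew-nonadjacent σ {x} {x} (Adjacent-irrefl G)

  relation : ∀ {x y z} → x ≢ y → x ≢ z → y ≢ z → ∀ i → S y z * S i x + (S z x * S i y + S x y * S i z) ≡ 0ℚ
  relation {x} {y} {z} x≢y x≢z y≢z i
    -- Among the four values `i`, `x`, `y`, `z` in `Fin 3` two coincide; since `x`, `y`, `z` are
    -- distinct, `i` is one of them.
    with Fin.pigeonhole (ℕ.n<1+n 3) (Vec.lookup (i ∷ x ∷ y ∷ z ∷ []))
  ... | zero , suc zero , _ , refl rewrite S-irrefl x | skew-antisym σ x z =
    solve 3 (λ p q r → p :* con 0ℚ :+ (q :* r :+ r :* (:- q)) := con 0ℚ) refl (S y z) (S z x) (S x y)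
  ... | zero , suc (suc zero) , _ , refl rewrite S-irrefl y | skew-antisym σ x y =
    solve 3 (λ p q r → p :* r :+ (q :* con 0ℚ :+ (:- r) :* p) := con 0ℚ) refl (S y z) (S z x) (S y x)
  ... | zero , suc (suc (suc zero)) , _ , refl rewrite S-irrefl z | skew-antisym σ y z =
    solve 3 (λ p q r → (:- p) :* q :+ (q :* p :+ r :* con 0ℚ) := con 0ℚ) refl (S z y) (S z x) (S x y)
  ... | suc zero , suc (suc zero) , _ , x≡y = contradiction x≡y x≢y
  ... | suc zero , suc (suc (suc zero)) , _ , x≡z = contradiction x≡z x≢z
  ... | suc (suc zero) , suc (suc (suc zero)) , _ , y≡z = contradiction y≡z y≢z
  ... | suc zero , suc zero , s≤s () , _
  ... | suc (suc zero) , suc zero , s≤s () , _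
  ... | suc (suc zero) , suc (suc zero) , s≤s (s≤s ()) , _
  ... | suc (suc (suc zero)) , suc zero , s≤s () , _
  ... | suc (suc (suc zero)) , suc (suc zero) , s≤s (s≤s ()) , _
  ... | suc (suc (suc zero)) , suc (suc (suc zero)) , s≤s (s≤s (s≤s ())) , _

-- Equality of both bounds and the extremal graphs.

-- The two inequalities say that both bounds behind the theorem are attained when α(G) = t. Asking only for
-- t ≤ α(G) saves an upper bound on the independence numbers of the star and the triangle.
record Tight {n} {G : Graph n} (σ : Orientation G) : Set where
  field
    t           : ℕ
    1≤t         : 1 ℕ.≤ t
    t≤α         : t ℕ.≤ α G
    rank-small  : sr σ ℕ.+ 2 ℕ.* t ℕ.+ 2 ℕ.* suc (size G) ℕ.≤ 4 ℕ.* n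
    pairs-large : n ℕ.* n ℕ.+ t ℕ.≤ t ℕ.* t ℕ.+ n ℕ.+ 2 ℕ.* size G

Extremal : ∀ {n} → Graph n → Set
Extremal {n} G = G ≅ star n ⊎ G ≅ triangle

-- From two vertices on, `t` counts the leaves. They are independent, so the pair count gives
-- `m ≤ n − 1`, while connectedness gives `m ≥ n − 1`.
star⇒tight : ∀ {n} {G : Graph n} (σ : Orientation G) → Connected G → ∀ {c} → StarCentre G c → Tight σ
star⇒tight {suc zero} {G} σ conn {zero} centre = record
  { t           = 1
  ; 1≤t         = s≤s z≤n
  ; t≤α         = α-positive G (s≤s z≤n)
  -- On one vertex there is room only for rank 0, so the general bound 2 for stars would not
  -- suffice.
  ; rank-small  = ℕ.≤-reflexive (cong₂ (λ r m → r ℕ.+ 2 ℕ.+ 2 ℕ.* suc m) (edgeless⇒sr≡0 σ none) m≡0)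
  ; pairs-large = ℕ.m≤m+n 2 _
  }
  where
  none : ∀ {x y} → ¬ Adjacent G x y
  none {zero} {zero} = Adjacent-irrefl G
  m≡0 : size G ≡ 0
  m≡0 = refl
star⇒tight {suc (suc k)} {G} σ conn {c} centre = record
  { t           = suc k
  ; 1≤t         = s≤s z≤n
  ; t≤α         = subst (ℕ._≤ α G) ∣p∣≡1+k (independent≤α G ind)
  ; rank-small  = begin
      sr σ ℕ.+ 2 ℕ.* suc k ℕ.+ 2 ℕ.* suc m
        ≡⟨ solve 3 (λ r k m → r :+ con 2 :* (con 1 :+ k) :+ con 2 :* (con 1 :+ m) := r :+ con 2 :* m :+ (con 4 :+ con 2 :* k))
             refl (sr σ) k m ⟩
      sr σ ℕ.+ 2 ℕ.* m ℕ.+ (4 ℕ.+ 2 ℕ.* k)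
        ≤⟨ ℕ.+-monoˡ-≤ (4 ℕ.+ 2 ℕ.* k) (ℕ.+-mono-≤ (star-sr≤2 σ centre) 2m≤) ⟩
      2 ℕ.+ 2 ℕ.* suc k ℕ.+ (4 ℕ.+ 2 ℕ.* k)
        ≡⟨ solve 1 (λ k → con 2 :+ con 2 :* (con 1 :+ k) :+ (con 4 :+ con 2 :* k) := con 4 :* (con 2 :+ k)) refl k ⟩
      4 ℕ.* suc (suc k) ∎
  ; pairs-large = begin
      suc (suc k) ℕ.* suc (suc k) ℕ.+ suc k
        ≡⟨ square-step ⟩
      suc k ℕ.* suc k ℕ.+ suc (suc k) ℕ.+ 2 ℕ.* suc k
        ≤⟨ ℕ.+-monoʳ-≤ (suc k ℕ.* suc k ℕ.+ suc (suc k)) (ℕ.*-monoʳ-≤ 2 (ℕ.≤-pred (connected-size G conn))) ⟩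
      suc k ℕ.* suc k ℕ.+ suc (suc k) ℕ.+ 2 ℕ.* m ∎
  }
  where
  open StarCentre centre
  open ℕ.≤-Reasoning
  open ℕ-Solver.+-*-Solver
  m = size G
  p = ∁ ⁅ c ⁆
  ≢c : ∀ {x} → x ∈ₛ p → x ≢ c
  ≢c x∈ refl = Subset.x∈∁p⇒x∉p x∈ (Subset.x∈⁅x⁆ c)
  ind : Independent G p
  ind x y x∈ y∈ = leaves (≢c x∈) (≢c y∈)
  ∣p∣≡1+k : ∣ p ∣ ≡ suc k
  ∣p∣≡1+k = trans (Subset.∣∁p∣≡n∸∣p∣ ⁅ c ⁆) (cong (suc (suc k) ℕ.∸_) (Subset.∣⁅x⁆∣≡1 c))
  square-step : suc (suc k) ℕ.* suc (suc k) ℕ.+ suc k ≡ suc k ℕ.* suc k ℕ.+ suc (suc k) ℕ.+ 2 ℕ.* suc k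
  square-step = solve 1 (λ k → (con 2 :+ k) :* (con 2 :+ k) :+ (con 1 :+ k) :=
    (con 1 :+ k) :* (con 1 :+ k) :+ (con 2 :+ k) :+ con 2 :* (con 1 :+ k)) refl k
  2m≤ : 2 ℕ.* m ℕ.≤ 2 ℕ.* suc k
  2m≤ = ℕ.+-cancelˡ-≤ (suc k ℕ.* suc k ℕ.+ suc (suc k)) _ _ (begin
    suc k ℕ.* suc k ℕ.+ suc (suc k) ℕ.+ 2 ℕ.* m
      ≤⟨ subst (λ a → a ℕ.* a ℕ.+ suc (suc k) ℕ.+ 2 ℕ.* m ℕ.≤ suc (suc k) ℕ.* suc (suc k) ℕ.+ a) ∣p∣≡1+k (independent-pairs G ind) ⟩
    suc (suc k) ℕ.* suc (suc k) ℕ.+ suc k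
      ≡⟨ square-step ⟩
    suc k ℕ.* suc k ℕ.+ suc (suc k) ℕ.+ 2 ℕ.* suc k ∎)

triangle⇒tight : ∀ {G : Graph 3} (σ : Orientation G) → Complete G → Tight σ
triangle⇒tight {G} σ complete = record
  { t           = 1
  ; 1≤t         = s≤s z≤n
  ; t≤α         = α-positive G (s≤s z≤n)
  ; rank-small  = subst (λ m → sr σ ℕ.+ 2 ℕ.+ 2 ℕ.* suc m ℕ.≤ 12) (sym (Complete-size G complete))
                    (ℕ.+-monoˡ-≤ 8 (ℕ.+-monoˡ-≤ 2 (triangle-sr≤2 σ complete)))
  ; pairs-large = ℕ.≤-reflexive (cong (λ m → 4 ℕ.+ 2 ℕ.* m) (sym (Complete-size G complete)))
  }

extremal⇒tight : ∀ {n} {G : Graph n} (σ : Orientation G) → Connected G → Extremal G → Tight σ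
extremal⇒tight {zero}  σ (() , _) _
extremal⇒tight {suc n} {G} σ conn (inj₁ iso) = star⇒tight σ conn (proj₂ (≅⇒StarCentre G iso))
extremal⇒tight {suc n} {G} σ conn (inj₂ iso) with refl ← Permutation.↔⇒≡ (proj₁ iso) =
  triangle⇒tight σ (≅⇒Complete G iso)

tight⇒extremal : ∀ {n} {G : Graph n} (σ : Orientation G) → Connected G →
                 sr σ ℕ.+ 2 ℕ.* α G ℕ.+ 2 ℕ.* suc (size G) ℕ.≤ 4 ℕ.* n →
                 n ℕ.* n ℕ.+ α G ≡ α G ℕ.* α G ℕ.+ n ℕ.+ 2 ℕ.* size G → Extremal G
tight⇒extremal {n} {G} σ conn rank-le pairs-eq
  with classify n (α G) (size G) (sr σ) α≤n (α-positive G (proj₁ conn))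
         (λ 2≤n → ℕ.≤-trans (ℕ.n≤1+n 1) (edge⇒2≤sr σ (proj₂ (proj₂ (some-edge G conn 2≤n)))))
         (connected-size G conn) pairs-eq rank-le
  where
  α≤n : α G ℕ.≤ n
  α≤n = let p , _ , ∣p∣≡α = maximumIndependentSet G in subst (ℕ._≤ n) ∣p∣≡α (Subset.∣p∣≤n p)
... | inj₁ refl                = inj₁ (StarCentre⇒≅ G (n≡1⇒star G))
... | inj₂ (inj₁ n≡1+α)        = inj₁ (StarCentre⇒≅ G (proj₂ (n≡1+α⇒star G conn n≡1+α)))
... | inj₂ (inj₂ (refl , α≡1)) = inj₂ (Complete⇒≅ G (α≡1⇒complete G α≡1))

-- Natural numbers as rationals, squares, and cuts of rational differences.

module _ where
  open ℚ-Solver.+-*-Solver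

  fromℕ-+ : ∀ m n → fromℕ (m ℕ.+ n) ≡ fromℕ m + fromℕ n
  fromℕ-+ zero    n = sym (ℚ.+-identityˡ (fromℕ n))
  fromℕ-+ (suc m) n = begin
    fromℕ (suc (m ℕ.+ n))       ≡⟨ Approximation.fromℕ-suc (m ℕ.+ n) ⟩
    1ℚ + fromℕ (m ℕ.+ n)        ≡⟨ cong (λ z → 1ℚ + z) (fromℕ-+ m n) ⟩
    1ℚ + (fromℕ m + fromℕ n)    ≡⟨ ℚ.+-assoc 1ℚ (fromℕ m) (fromℕ n) ⟨
    1ℚ + fromℕ m + fromℕ n      ≡⟨ cong (_+ fromℕ n) (Approximation.fromℕ-suc m) ⟨
    fromℕ (suc m) + fromℕ n     ∎
    where open ≡-Reasoning

  fromℕ-* : ∀ m n → fromℕ (m ℕ.* n) ≡ fromℕ m * fromℕ n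
  fromℕ-* zero    n = sym (ℚ.*-zeroˡ (fromℕ n))
  fromℕ-* (suc m) n = begin
    fromℕ (n ℕ.+ m ℕ.* n)       ≡⟨ fromℕ-+ n (m ℕ.* n) ⟩
    fromℕ n + fromℕ (m ℕ.* n)   ≡⟨ cong (λ z → fromℕ n + z) (fromℕ-* m n) ⟩
    fromℕ n + fromℕ m * fromℕ n ≡⟨ Approximation.fromℕ-suc-* m (fromℕ n) ⟨
    fromℕ (suc m) * fromℕ n     ∎
    where open ≡-Reasoning

  0≤fromℕ : ∀ n → 0ℚ ≤ fromℕ n
  0≤fromℕ zero    = ℚ.≤-refl
  0≤fromℕ (suc n) = subst (0ℚ ≤_) (sym (Approximation.fromℕ-suc n))
    (ℚ.+-mono-≤ (ℚ.nonNegative⁻¹ 1ℚ) (0≤fromℕ n))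

  ≤-from-difference : ∀ {p q d} → 0ℚ ≤ d → q ≡ p + d → p ≤ q
  ≤-from-difference {p} {q} {d} 0≤d refl = subst (_≤ p + d) (ℚ.+-identityʳ p) (ℚ.+-monoʳ-≤ p 0≤d)

  <-from-difference : ∀ {p q d} → 0ℚ < d → q ≡ p + d → p < q
  <-from-difference {p} {q} {d} 0<d refl = subst (_< p + d) (ℚ.+-identityʳ p) (ℚ.+-monoʳ-< p 0<d)

  difference-nonneg : ∀ {p q} → p ≤ q → 0ℚ ≤ q - p
  difference-nonneg {p} {q} p≤q = subst (_≤ q - p) (ℚ.+-inverseʳ p) (ℚ.+-monoˡ-≤ (- p) p≤q)

  difference-pos : ∀ {p q} → p < q → 0ℚ < q - p
  difference-pos {p} {q} p<q = subst (_< q - p) (ℚ.+-inverseʳ p) (ℚ.+-monoˡ-< (- p) p<q)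

  fromℕ-mono-≤ : ∀ {m n} → m ℕ.≤ n → fromℕ m ≤ fromℕ n
  fromℕ-mono-≤ {m} m≤n with o , refl ← ℕ.m≤n⇒∃[o]m+o≡n m≤n = ≤-from-difference (0≤fromℕ o) (fromℕ-+ m o)

  fromℕ-cancel-≤ : ∀ {m n} → fromℕ m ≤ fromℕ n → m ℕ.≤ n
  fromℕ-cancel-≤ {m} {n} le = ℕ.≮⇒≥ λ n<m → ℚ.<-irrefl refl (ℚ.<-≤-trans
    (<-from-difference (ℚ.positive⁻¹ 1ℚ) (trans (Approximation.fromℕ-suc n) (ℚ.+-comm 1ℚ (fromℕ n))))
    (ℚ.≤-trans (fromℕ-mono-≤ n<m) le))

  square-mono-< : ∀ {p q} → 0ℚ ≤ p → p < q → p * p < q * q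
  square-mono-< {p} {q} 0≤p p<q = ℚ.≤-<-trans
    (ℚ.*-monoˡ-≤-nonNeg p {{nonNegative 0≤p}} (ℚ.<⇒≤ p<q))
    (ℚ.*-monoˡ-<-pos q {{positive (ℚ.≤-<-trans 0≤p p<q)}} p<q)

  square-cancel-≤ : ∀ {p q} → 0ℚ ≤ q → p * p ≤ q * q → p ≤ q
  square-cancel-≤ 0≤q pp≤qq = ℚ.≮⇒≥ λ q<p → ℚ.<-irrefl refl (ℚ.<-≤-trans (square-mono-< 0≤q q<p) pp≤qq)

  -- If p² + 1 ≤ d then √d > p: the rational p + 1/(2p + 1) still has square at most d.
  square-gap : ∀ {p d} → 0ℚ ≤ p → p * p + 1ℚ ≤ d → ∃ λ e → 0ℚ < e × (p + e) * (p + e) ≤ d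
  square-gap {p} {d} 0≤p gap = e , ℚ.positive⁻¹ e {{ℚ.1/pos⇒pos w}} , ℚ.≤-trans
    (≤-from-difference
      (subst (_≤ e * (1ℚ - e)) (ℚ.*-zeroʳ e) (ℚ.*-monoˡ-≤-nonNeg e (difference-nonneg e≤1)))
      (trans (cong (λ z → p * p + z) (sym e*w))
        (solve 2 (λ p e → p :* p :+ e :* (con 1ℚ :+ (p :+ p)) := (p :+ e) :* (p :+ e) :+ e :* (con 1ℚ :- e)) refl p e)))
    gap
    where
    w = 1ℚ + (p + p)
    1≤w : 1ℚ ≤ w
    1≤w = ≤-from-difference (ℚ.+-mono-≤ 0≤p 0≤p) refl
    instance
      w-positive : Positive w
      w-positive = positive (ℚ.<-≤-trans (ℚ.positive⁻¹ 1ℚ) 1≤w)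
      w-nonZero : NonZero w
      w-nonZero = ℚ.pos⇒nonZero w
    e = 1/ w
    instance
      e-nonNegative : NonNegative e
      e-nonNegative = ℚ.pos⇒nonNeg e {{ℚ.1/pos⇒pos w}}
    e*w : e * w ≡ 1ℚ
    e*w = ℚ.*-inverseˡ w
    e≤1 : e ≤ 1ℚ
    e≤1 = subst₂ _≤_ (ℚ.*-identityʳ e) e*w (ℚ.*-monoˡ-≤-nonNeg e 1≤w)

  -- A rational strictly between `q + p′` and `p` splits `q` with room in both summands, as open
  -- cuts demand.
  lower-difference⁺ : ∀ {p p′ q} → q < p - p′ → Lower (fromℚ p -ᴿ fromℚ p′) q
  lower-difference⁺ {p} {p′} {q} q<p-p′ =
    let r , q+p′<r , r<p = ℚ.<-dense {q + p′} {p} (<-from-difference (difference-pos q<p-p′)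
          (solve 3 (λ p p′ q → p := q :+ p′ :+ ((p :- p′) :- q)) refl p p′ q))
    in r , q - r , r<p ,
       <-from-difference (difference-pos q+p′<r)
         (solve 3 (λ p′ q r → :- (q :- r) := p′ :+ (r :- (q :+ p′))) refl p′ q r) ,
       solve 2 (λ q r → q := r :+ (q :- r)) refl q r

  lower-difference⁻ : ∀ {p p′ q} → Lower (fromℚ p -ᴿ fromℚ p′) q → q < p - p′
  lower-difference⁻ {p} {p′} (r , s , r<p , p′<-s , refl) = <-from-difference
    (ℚ.+-mono-< (difference-pos r<p) (difference-pos p′<-s))
    (solve 4 (λ p p′ r s → p :- p′ := r :+ s :+ ((p :- r) :+ (:- s :- p′))) refl p p′ r s)

-- The right-hand side as a cut, with rational part `A` and radicand `D`.

bound : ℚ → ℚ → ℝ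
bound A D = fromℚ A -ᴿ fromℕ 3 ·ᴿ √ D -ᴿ fromℚ (+ 7 / 2)

module _ where
  open ℚ-Solver.+-*-Solver

  private
    ⅓ = + 1 / 3

  -- The root is subtracted, so a lower approximation of the whole contains an upper approximation
  -- of `√ D`, which lies above some `r ≥ 0` with `D ≤ r²`.
  lower-bound⁻ : ∀ {A D q} → Lower (bound A D) q → ∃ λ r → 0ℚ ≤ r × D ≤ r * r × q < A - fromℕ 3 * r - + 7 / 2
  lower-bound⁻ {A} (_ , w , (u , v , u<A , (r , r<-v/3 , 0≤r , D≤rr) , refl) , 7/2<-w , refl) =
    r , 0≤r , D≤rr , <-from-difference
      (ℚ.+-mono-< (ℚ.+-mono-< (difference-pos u<A) (ℚ.*-monoʳ-<-pos (fromℕ 3) (difference-pos r<-v/3))) (difference-pos 7/2<-w))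
      (solve 5 (λ A u v w r → A :- con (fromℕ 3) :* r :- con (+ 7 / 2) :=
          u :+ v :+ w :+ ((A :- u) :+ con (fromℕ 3) :* (con ⅓ :* (:- v) :- r) :+ (:- w :- con (+ 7 / 2))))
        refl A u v w r)

  lower-bound⁺ : ∀ {A D q r} → 0ℚ ≤ r → D ≤ r * r → q < A - fromℕ 3 * r - + 7 / 2 → Lower (bound A D) q
  lower-bound⁺ {A} {D} {q} {r} 0≤r D≤rr q<rhs =
    u + v , w , (u , v , u<A , (r , r<-v/3 , 0≤r , D≤rr) , refl) , 7/2<-w ,
    solve 3 (λ A r q → let δ = con ⅓ :* (A :- con (fromℕ 3) :* r :- con (+ 7 / 2) :- q) in
        q := (A :- δ) :+ (:- (con (fromℕ 3) :* r) :- δ) :+ (:- con (+ 7 / 2) :- δ)) refl A r q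
    where
    -- A third of the available room for each of the summands `u`, `v` and `w`.
    δ = ⅓ * (A - fromℕ 3 * r - + 7 / 2 - q)
    0<δ : 0ℚ < δ
    0<δ = ℚ.*-monoʳ-<-pos ⅓ (difference-pos q<rhs)
    u = A - δ
    v = - (fromℕ 3 * r) - δ
    w = - (+ 7 / 2) - δ
    u<A : u < A
    u<A = <-from-difference 0<δ (solve 2 (λ A δ → A := A :- δ :+ δ) refl A δ)
    r<-v/3 : r < ⅓ * - v
    r<-v/3 = <-from-difference (ℚ.*-monoʳ-<-pos ⅓ 0<δ)
      (solve 2 (λ r δ → con ⅓ :* :- (:- (con (fromℕ 3) :* r) :- δ) := r :+ con ⅓ :* δ) refl r δ)
    7/2<-w : + 7 / 2 < - w
    7/2<-w = <-from-difference 0<δ (solve 1 (λ δ → :- (:- con (+ 7 / 2) :- δ) := con (+ 7 / 2) :+ δ) refl δ)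

-- Comparison of the two real sides.

module Comparison (n m r a : ℕ)
  (1≤a : 1 ℕ.≤ a)
  (rank-large : 4 ℕ.* n ℕ.≤ r ℕ.+ 2 ℕ.* a ℕ.+ 2 ℕ.* suc m)
  (pairs-small : a ℕ.* a ℕ.+ n ℕ.+ 2 ℕ.* m ℕ.≤ n ℕ.* n ℕ.+ a)
  where

  open ℚ-Solver.+-*-Solver

  N = fromℕ n
  M = fromℕ m
  A = fromℕ 4 * N - fromℕ 2 * M
  D = N * (N - 1ℚ) - fromℕ 2 * M + (+ 1 / 4)

  lhs rhs : ℝ
  lhs = fromℚ (fromℕ r) -ᴿ fromℚ (fromℕ a)
  rhs = bound A D

  private
    rank-term : ∀ t → fromℕ (r ℕ.+ 2 ℕ.* t ℕ.+ 2 ℕ.* suc m) ≡ fromℕ r + fromℕ 2 * fromℕ t + fromℕ 2 * (1ℚ + M)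
    rank-term t = trans (fromℕ-+ (r ℕ.+ 2 ℕ.* t) (2 ℕ.* suc m)) (cong₂ _+_
      (trans (fromℕ-+ r (2 ℕ.* t)) (cong (λ z → fromℕ r + z) (fromℕ-* 2 t)))
      (trans (fromℕ-* 2 (suc m)) (cong (fromℕ 2 *_) (Approximation.fromℕ-suc m))))

    pairs-term : ∀ t → fromℕ (t ℕ.* t ℕ.+ n ℕ.+ 2 ℕ.* m) ≡ fromℕ t * fromℕ t + N + fromℕ 2 * M
    pairs-term t = trans (fromℕ-+ (t ℕ.* t ℕ.+ n) (2 ℕ.* m)) (cong₂ _+_
      (trans (fromℕ-+ (t ℕ.* t) n) (cong (_+ N) (fromℕ-* t t)))
      (fromℕ-* 2 m))

    square-term : ∀ t → fromℕ (n ℕ.* n ℕ.+ t) ≡ N * N + fromℕ t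
    square-term t = trans (fromℕ-+ (n ℕ.* n) t) (cong (_+ fromℕ t) (fromℕ-* n n))

    -- The right-hand side when √D = t − ½, that is, when t(t − 1) = n(n − 1) − 2m.
    value : ℕ → ℚ
    value t = A - fromℕ 3 * (fromℕ t - ½) - + 7 / 2

    0≤t-½ : ∀ {t} → 1 ℕ.≤ t → 0ℚ ≤ fromℕ t - ½
    0≤t-½ {t} 1≤t = difference-nonneg (ℚ.≤-trans (≤-from-difference {½} {1ℚ} (ℚ.nonNegative⁻¹ ½) refl) (fromℕ-mono-≤ 1≤t))

    -- The ¼ in the radicand completes the square: `D − (a − ½)²` is exactly the slack in
    -- `pairs-small`.
    root≤ : (fromℕ a - ½) * (fromℕ a - ½) ≤ D
    root≤ = ≤-from-difference
      (difference-nonneg (subst₂ _≤_ (pairs-term a) (square-term a) (fromℕ-mono-≤ pairs-small)))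
      (solve 3 (λ N M a → N :* (N :- con 1ℚ) :- con (fromℕ 2) :* M :+ con (+ 1 / 4) :=
          (a :- con ½) :* (a :- con ½) :+ (N :* N :+ a :- (a :* a :+ N :+ con (fromℕ 2) :* M)))
        refl N M (fromℕ a))

    -- Since `3/2 − 7/2 = −2`, the two sides at `√D = a − ½` differ exactly by the slack in
    -- `rank-large`.
    value-gap : fromℕ r - fromℕ a ≡ value a + (fromℕ r + fromℕ 2 * fromℕ a + fromℕ 2 * (1ℚ + M) - fromℕ 4 * N)
    value-gap = solve 4 (λ N M r a → r :- a :=
            con (fromℕ 4) :* N :- con (fromℕ 2) :* M :- con (fromℕ 3) :* (a :- con ½) :- con (+ 7 / 2) :+
            (r :+ con (fromℕ 2) :* a :+ con (fromℕ 2) :* (con 1ℚ :+ M) :- con (fromℕ 4) :* N))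
          refl N M (fromℕ r) (fromℕ a)

    value≤ : value a ≤ fromℕ r - fromℕ a
    value≤ = ≤-from-difference
      (difference-nonneg (subst₂ _≤_ (fromℕ-* 4 n) (rank-term a) (fromℕ-mono-≤ rank-large)))
      value-gap

    antitone : ∀ s t → s ≤ t → A - fromℕ 3 * t - + 7 / 2 ≤ A - fromℕ 3 * s - + 7 / 2
    antitone s t s≤t = ≤-from-difference (ℚ.*-monoˡ-≤-nonNeg (fromℕ 3) (difference-nonneg s≤t))
      (solve 3 (λ A s t → A :- con (fromℕ 3) :* s :- con (+ 7 / 2) :=
          A :- con (fromℕ 3) :* t :- con (+ 7 / 2) :+ con (fromℕ 3) :* (t :- s)) refl A s t)

    -- Every upper approximation of `√D` is at least `s`, and subtracting more yields less.
    lower⇒<value : ∀ {q} s → s * s ≤ D → Lower rhs q → q < A - fromℕ 3 * s - + 7 / 2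
    lower⇒<value s ss≤D Lq = let t , 0≤t , D≤tt , q< = lower-bound⁻ {A} {D} Lq in
      ℚ.<-≤-trans q< (antitone s t (square-cancel-≤ 0≤t (ℚ.≤-trans ss≤D D≤tt)))

  lhs≥rhs : lhs ≥ᴿ rhs
  lhs≥rhs q Lq = lower-difference⁺ (ℚ.<-≤-trans (lower⇒<value (fromℕ a - ½) root≤ Lq) value≤)

  -- Were the rank bound strict, `value a` would lie in the lower cut of `lhs`, hence of `rhs`, and
  -- so be less than itself.
  lhs≤rhs⇒rank : lhs ≤ᴿ rhs → r ℕ.+ 2 ℕ.* a ℕ.+ 2 ℕ.* suc m ℕ.≤ 4 ℕ.* n
  lhs≤rhs⇒rank lhs≤rhs = fromℕ-cancel-≤ (subst₂ _≤_ (sym (rank-term a)) (sym (fromℕ-* 4 n)) (ℚ.≮⇒≥ λ strict →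
    ℚ.<-irrefl refl (lower⇒<value (fromℕ a - ½) root≤ (lhs≤rhs (value a) (lower-difference⁺ (<-from-difference (difference-pos strict)
      value-gap))))))

  -- A strict inequality between integers leaves a gap of 1, so `√D` is at least `s + e` for some
  -- positive `e`. The value `q` at `s + e` lies below `value a`, hence in the lower cut of `lhs`
  -- and of `rhs`, which forces `q < q`.
  lhs≤rhs⇒pairs : lhs ≤ᴿ rhs → n ℕ.* n ℕ.+ a ≡ a ℕ.* a ℕ.+ n ℕ.+ 2 ℕ.* m
  lhs≤rhs⇒pairs lhs≤rhs = ℕ.≤-antisym (ℕ.≮⇒≥ refute) pairs-small
    where
    refute : ¬ (a ℕ.* a ℕ.+ n ℕ.+ 2 ℕ.* m ℕ.< n ℕ.* n ℕ.+ a)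
    refute strict = ℚ.<-irrefl refl (lower⇒<value (s + e) tt≤D (lhs≤rhs q (lower-difference⁺ (ℚ.<-≤-trans q<value value≤))))
      where
      s = fromℕ a - ½
      gap : s * s + 1ℚ ≤ D
      gap = ≤-from-difference
        (difference-nonneg (subst₂ _≤_ (trans (Approximation.fromℕ-suc (a ℕ.* a ℕ.+ n ℕ.+ 2 ℕ.* m)) (cong (λ z → 1ℚ + z) (pairs-term a))) (square-term a) (fromℕ-mono-≤ strict)))
        (solve 3 (λ N M a → N :* (N :- con 1ℚ) :- con (fromℕ 2) :* M :+ con (+ 1 / 4) :=
            (a :- con ½) :* (a :- con ½) :+ con 1ℚ :+ (N :* N :+ a :- (con 1ℚ :+ (a :* a :+ N :+ con (fromℕ 2) :* M))))
          refl N M (fromℕ a))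
      larger-root = square-gap (0≤t-½ 1≤a) gap
      e = proj₁ larger-root
      tt≤D = proj₂ (proj₂ larger-root)
      q = A - fromℕ 3 * (s + e) - + 7 / 2
      q<value : q < value a
      q<value = <-from-difference (ℚ.*-monoʳ-<-pos (fromℕ 3) (proj₁ (proj₂ larger-root)))
        (solve 3 (λ A s e → A :- con (fromℕ 3) :* s :- con (+ 7 / 2) :=
            A :- con (fromℕ 3) :* (s :+ e) :- con (+ 7 / 2) :+ con (fromℕ 3) :* e) refl A s e)

  -- The pair inequality makes `t − ½` an upper bound for `√D`, and the rank inequality gives
  -- `r − t ≤ value t`; finally `r − a ≤ r − t`.
  lhs≤rhs : ∀ {t} → 1 ℕ.≤ t → t ℕ.≤ a → r ℕ.+ 2 ℕ.* t ℕ.+ 2 ℕ.* suc m ℕ.≤ 4 ℕ.* n →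
            n ℕ.* n ℕ.+ t ℕ.≤ t ℕ.* t ℕ.+ n ℕ.+ 2 ℕ.* m → lhs ≤ᴿ rhs
  lhs≤rhs {t} 1≤t t≤a rank-small pairs-large q Lq = lower-bound⁺ {A} {D} (0≤t-½ 1≤t)
    (≤-from-difference
      (difference-nonneg (subst₂ _≤_ (square-term t) (pairs-term t) (fromℕ-mono-≤ pairs-large)))
      (solve 3 (λ N M t → (t :- con ½) :* (t :- con ½) :=
          N :* (N :- con 1ℚ) :- con (fromℕ 2) :* M :+ con (+ 1 / 4) :+
          (t :* t :+ N :+ con (fromℕ 2) :* M :- (N :* N :+ t)))
        refl N M (fromℕ t)))
    (ℚ.<-≤-trans (lower-difference⁻ Lq) (≤-from-difference
      (ℚ.+-mono-≤ (difference-nonneg (fromℕ-mono-≤ t≤a))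
        (difference-nonneg (subst₂ _≤_ (rank-term t) (fromℕ-* 4 n) (fromℕ-mono-≤ rank-small))))
      (solve 5 (λ N M r a t →
          con (fromℕ 4) :* N :- con (fromℕ 2) :* M :- con (fromℕ 3) :* (t :- con ½) :- con (+ 7 / 2) :=
          r :- a :+ ((a :- t) :+ (con (fromℕ 4) :* N :- (r :+ con (fromℕ 2) :* t :+ con (fromℕ 2) :* (con 1ℚ :+ M)))))
        refl N M (fromℕ r) (fromℕ a) (fromℕ t))))

theorem1p5 : ∀ {n : ℕ} (G : Graph n) (σ : Orientation G) → Connected G →
    let N = fromℕ n
        M = fromℕ (size G)
        lhs = fromℚ (fromℕ (sr σ)) -ᴿ fromℚ (fromℕ (α G))
        rhs = fromℚ (fromℕ 4 * N - fromℕ 2 * M)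
              -ᴿ fromℕ 3 ·ᴿ √ (N * (N - 1ℚ) - fromℕ 2 * M + (+ 1 / 4))
              -ᴿ fromℚ (+ 7 / 2)
    in (lhs ≥ᴿ rhs) × ((lhs ≈ᴿ rhs) ⇔ (G ≅ star n ⊎ G ≅ triangle))
theorem1p5 {n} G σ conn = lhs≥rhs , mk⇔
  -- One half of `≈ᴿ` always holds, so equality amounts to `lhs ≤ᴿ rhs`.
  (λ (lhs≤ , _) → tight⇒extremal σ conn (lhs≤rhs⇒rank lhs≤) (lhs≤rhs⇒pairs lhs≤))
  (λ extremal → let open Tight (extremal⇒tight σ conn extremal) in
     lhs≤rhs 1≤t t≤α rank-small pairs-large , lhs≥rhs)
  where
  maximal = maximumIndependentSet G
  open Comparison n (size G) (sr σ) (α G)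
    (α-positive G (proj₁ conn))
    (rank-independence-bound σ conn)
    (subst (λ k → k ℕ.* k ℕ.+ n ℕ.+ 2 ℕ.* size G ℕ.≤ n ℕ.* n ℕ.+ k) (proj₂ (proj₂ maximal))
      (independent-pairs G (proj₁ (proj₂ maximal))))
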